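{- Let $\mathcal{O}$ be the class of all outerplanar graphs. Then (a) $3 \le \chi_{\mathrm{iCFo}}(\mathcal{O}) \le 4$; (b) $\chi_{\mathrm{iCFc}}(\mathcal{O}) = 3$; (c) $4 \le \chi_{\mathrm{iUMo}}(\mathcal{O}) \le 5$; (d) $3 \le \chi_{\mathrm{iUMc}}(\mathcal{O}) \le 5$.
   Context: $N(v)$ denotes the open neighborhood of a vertex $v$ and $N[v]=N(v)\cup\{v\}$ its closed neighborhood. Colorings with $k$ colors assign to vertices colors from $\{1,\dots,k\}$; they need not be proper here. An iCFo-coloring (resp. iCFc-coloring) of a graph $G$ (conflict-free coloring with respect to open, resp. closed, neighborhood) is a coloring of the vertices such that for every vertex $v$ there is at least one color appearing on exactly one vertex of $N(v)$ (resp. $N[v]$). An iUMo-coloring (resp. iUMc-coloring) of $G$ (unique-maximum coloring with respect to open, resp. closed, neighborhood) is a coloring of the vertices such that for every vertex $v$, the maximum color appearing on $N(v)$ (resp. $N[v]$) appears on exactly one vertex of $N(v)$ (resp. $N[v]$). $\chi_{\mathrm{iCFo}}(G)$, $\chi_{\mathrm{iCFc}}(G)$, $\chi_{\mathrm{iUMo}}(G)$, $\chi_{\mathrm{iUMc}}(G)$ denote the minimum $k$ such that $G$ has, respectively, an iCFo-, iCFc-, iUMo-, iUMc-coloring with $k$ colors. For an invariant $\chi_{.}$ and a graph class $\mathcal{C}$, $\chi_{.}(\mathcal{C}) = \max\{\chi_{.}(G) \mid G \in \mathcal{C}\}$. For the open neighborhood variants, only graphs without isolated vertices are considered (i.e.,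 in (a) and (c) the maximum is over graphs in the class having no isolated vertices). -}

module Defs where

open import Data.Fin.Base using (Fin; _<_; _≤_)
open import Data.Fin.Permutation using (Permutation′; _⟨$⟩ʳ_)
open import Data.Nat.Base as ℕ using (ℕ)
open import Data.Product using (_×_; ∃; ∃!)
open import Data.Sum.Base using (_⊎_)
open import Level using (0ℓ)
open import Relation.Binary using (Rel; Symmetric; Irreflexive; Decidable)
open import Relation.Binary.PropositionalEquality using (_≡_)
open import Relation.Nullary using (¬_)
open import Relation.Unary using (Pred; _∩_)

record Graph : Set₁ where
  field
    order  : ℕ
    Adj    : Rel (Fin order) 0ℓ
    sym    : Symmetric Adj
    irrefl : Irreflexive _≡_ Adj
    adj?   : Decidable Adj

  Vertex : Set
  Vertex = Fin order

open Graph public using (order; Vertex)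

-- Open and closed neighbourhoods, as sets of vertices.

N : (G : Graph) → Vertex G → Pred (Vertex G) 0ℓ
N G v = Graph.Adj G v

N[_] : (G : Graph) → Vertex G → Pred (Vertex G) 0ℓ
N[ G ] v u = u ≡ v ⊎ Graph.Adj G v u

NoIsolated : Pred Graph 0ℓ
NoIsolated G = ∀ v → ∃ λ u → N G v u

-- A drawing with every vertex on the outer face is recorded, up to
-- homeomorphism, as a drawing in a closed disc: the exterior of the disc lies in
-- the outer face, the vertices lie on the bounding circle, and the edges are
-- arcs inside the disc.  Only the cyclic order of the vertices matters: two
-- edges can be drawn without crossing iff their ends do not alternate on the
-- circle.  The position function cuts that cyclic order open at an arbitrary
-- point, which does not affect alternation.  The symmetry of Adj makes the
-- single pattern a < c < b < d cover all alternating pairs of edges.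

NonCrossing : (G : Graph) → Permutation′ (order G) → Set
NonCrossing G pos =
  ∀ {a b c d} → Graph.Adj G a b → Graph.Adj G c d →
  ¬ (pos ⟨$⟩ʳ a < pos ⟨$⟩ʳ c × pos ⟨$⟩ʳ c < pos ⟨$⟩ʳ b × pos ⟨$⟩ʳ b < pos ⟨$⟩ʳ d)

Outerplanar : Pred Graph 0ℓ
Outerplanar G = ∃ λ (pos : Permutation′ (order G)) → NonCrossing G pos

-- Fin k, with its usual order, stands for the colour set {1,…,k}.

Coloring : Graph → ℕ → Set
Coloring G k = Vertex G → Fin k

module _ {G : Graph} {k : ℕ} (φ : Coloring G k) where

  OccursOnceIn : Pred (Vertex G) 0ℓ → Pred (Fin k) 0ℓ
  OccursOnceIn S c = ∃! _≡_ λ u → S u × φ u ≡ c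

  IsMaxColorOf : Pred (Vertex G) 0ℓ → Pred (Fin k) 0ℓ
  IsMaxColorOf S c = (∃ λ u → S u × φ u ≡ c) × (∀ {u} → S u → φ u ≤ c)

  ConflictFree : (Vertex G → Pred (Vertex G) 0ℓ) → Set
  ConflictFree nbhd = ∀ v → ∃ λ c → OccursOnceIn (nbhd v) c

  UniqueMaximum : (Vertex G → Pred (Vertex G) 0ℓ) → Set
  UniqueMaximum nbhd =
    ∀ v → ∃ λ c → IsMaxColorOf (nbhd v) c × OccursOnceIn (nbhd v) c

iCFo-colorable iCFc-colorable iUMo-colorable iUMc-colorable : Graph → Pred ℕ 0ℓ
iCFo-colorable G k = ∃ λ (φ : Coloring G k) → ConflictFree  {G} φ (N G)
iCFc-colorable G k = ∃ λ (φ : Coloring G k) → ConflictFree  {G} φ N[ G ]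
iUMo-colorable G k = ∃ λ (φ : Coloring G k) → UniqueMaximum {G} φ (N G)
iUMc-colorable G k = ∃ λ (φ : Coloring G k) → UniqueMaximum {G} φ N[ G ]

IsMinimum : Pred ℕ 0ℓ → Pred ℕ 0ℓ
IsMinimum P m = P m × (∀ {k} → P k → m ℕ.≤ k)

-- An invariant is given by its graph: χ-iCFo G m says that χ_iCFo(G) exists and
-- equals m.

χ-iCFo χ-iCFc χ-iUMo χ-iUMc : Graph → Pred ℕ 0ℓ
χ-iCFo G = IsMinimum (iCFo-colorable G)
χ-iCFc G = IsMinimum (iCFc-colorable G)
χ-iUMo G = IsMinimum (iUMo-colorable G)
χ-iUMc G = IsMinimum (iUMc-colorable G)

-- Assertions about max {χ(G) | G ∈ 𝒞}.  Constructively, naming the exact value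
-- of a maximum only known to lie in an interval would amount to deciding which
-- value it is, so a bound on the maximum is expressed on the members of the
-- class: it is at least k iff some χ(G) is, and at most k iff every χ(G) is.

module _ (χ : Graph → Pred ℕ 0ℓ) (𝒞 : Pred Graph 0ℓ) where

  Max≥ : ℕ → Set₁
  Max≥ k = ∃ λ G → 𝒞 G × ∃ λ m → χ G m × k ℕ.≤ m

  Max≤ : ℕ → Set₁
  Max≤ k = ∀ G → 𝒞 G → ∃ λ m → χ G m × m ℕ.≤ k

  Max≡ : ℕ → Set₁
  Max≡ k = (∃ λ G → 𝒞 G × χ G k) × Max≤ k

𝒪 : Pred Graph 0ℓ
𝒪 = Outerplanar

-- The members of 𝒪 admitted for the open-neighbourhood invariants.

𝒪⁺ : Pred Graph 0ℓ
𝒪⁺ = Outerplanar ∩ NoIsolated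

{-# OPTIONS --safe #-}
module Submission where

-- Four colours suffice for iUMo, and three for iUMc; as a unique-maximum colouring is conflict-free,
-- this gives all the upper bounds.  Both are proved by a finite-state argument along the line of
-- vertices.  If m is the last neighbour of a before b (or a + 1), every edge within [a , b] but ab
-- lies within [a , m] or [m , b], so that the graph on [a , b] is glued from two smaller ones and
-- possibly the chord ab.  How a coloured piece interacts with the rest depends only on the colours of
-- a and b and on the largest colour that each of them has seen so far, and whether more than once.
-- A certificate is a finite family of sets of such end states, closed under gluing and adding chords;
-- by induction every interval admits colourings with all the end states of some member of the family,
-- and every member contains a state in which both ends are satisfied.
--
-- The lower bounds come from the triangle, the bull, and two paths on five vertices whose vertices
-- other than the middle ones are joined to a common hub.

open import Data.Bool.Base using (Bool; true; false; T; _∧_; _∨_; not; if_then_else_)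
open import Data.Bool.ListAction using (any; all)
open import Data.Bool.Properties using (T-∧; T-∨; T-≡)
open import Data.Empty using (⊥; ⊥-elim)
open import Data.Fin using (#_)
open import Data.Fin.Base as Fin using (Fin; toℕ; fromℕ<; finToFun; funToFin; inject≤)
open import Data.Fin.Permutation as Permutation using (Permutation′; _⟨$⟩ʳ_; _⟨$⟩ˡ_; inverseˡ; inverseʳ)
import Data.Fin.Properties as Fin
open import Data.List.Base using (List; []; _∷_; drop; map)
open import Data.List.Membership.Propositional using (_∈_; find)
open import Data.List.Relation.Unary.All as All using (All)
open import Data.List.Relation.Unary.All.Properties using (all⁺)
open import Data.List.Relation.Unary.Any using (here; there)
open import Data.List.Relation.Unary.Any.Properties using (any⁻)
open import Data.Nat.Base
open import Data.Nat.DivMod using (m*n/n≡m; m*n%n≡0)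
open import Data.Nat.Properties
open import Data.Product using (_×_; _,_; ∃; proj₁; proj₂; map₁; map₂; swap)
open import Data.Product.Properties using (≡-dec)
open import Data.List.Membership.DecPropositional (≡-dec _≟_ _≟_) using (_∈?_)
open import Data.Sum.Base as Sum using (_⊎_; inj₁; inj₂; [_,_])
open import Data.Unit.Base using (⊤; tt)
open import Data.Vec.Base as Vec using (Vec; []; _∷_; lookup)
open import Data.Vec.Properties using (lookup-map)
open import Function.Base using (_∘_; case_of_)
open import Function.Bundles using (Equivalence)
open import Level using (0ℓ)
open import Relation.Binary.Core using (Rel)
open import Relation.Binary.Definitions as B using (Symmetric; tri<; tri≈; tri>)
open import Relation.Binary.PropositionalEquality
  using (_≡_; _≗_; refl; sym; trans; cong; cong₂; subst; subst₂)
open import Relation.Nullary using (¬_; Dec; yes; no; contradiction)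
open import Relation.Nullary.Decidable
  using (True; toWitness; toWitnessFalse; map′; ¬?; _×-dec_; _⊎-dec_; _→-dec_)
open import Relation.Unary using (Pred; Decidable; _∪_)
open import Defs

-- Observations

-- Which end state of a piece is wanted depends on the rest of the graph, so a single colouring of
-- each piece is not enough: the induction carries a whole set of end states, each realised by a
-- colouring of its own. A member of the family need only be a subset of what a piece can realise,
-- and this freedom to discard states keeps the family small. The choice of m makes the two pieces
-- unequal. As m is a neighbour of a or equals a + 1, the left piece is spanned by an edge or
-- consists of two consecutive non-adjacent vertices, while the right piece is arbitrary. Hence
-- there are two families, and only pairs of a left and a right type have to be checked. For open
-- neighbourhoods a vertex without neighbours can never be satisfied, so closure under gluing must
-- fail where the middle vertex sees nothing on either side; such pairs are exempted and refuted by
-- the absence of isolated vertices. Colours run from 0, so four colours give observations up to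
-- `many 3`, which is 8: one decimal digit holds an observation.

odd : ℕ → Bool
odd 0 = false
odd (suc n) = not (odd n)

-- What a vertex sees of a set of coloured vertices is recorded as a single number, its observation:
-- 0 for the empty set, once c if the largest colour is c and is attained once, many c if nothing
-- more is known than that no colour exceeds c.  The order of ℕ puts once c just below many c, so that
-- the observation of a union is the maximum, except that once c and once c combine to many c.
once many : ℕ → ℕ
once c = suc (c + c)
many c = suc (once c)

odd-once : ∀ c → odd (once c) ≡ true
odd-once zero = refl
odd-once (suc c) rewrite +-suc c c = cong not (cong not (odd-once c))

_⊕_ : ℕ → ℕ → ℕ
x ⊕ y = if (x ≡ᵇ y) ∧ odd x then suc x else (if x <ᵇ y then y else x)

-- An even observation claims only a bound, so it may overstate what is seen; only odd ones promise
-- a unique top vertex. A colour spoiled by a tie becomes harmless again once a larger colour is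
-- added.
record Summary (φ : ℕ → ℕ) (S : Pred ℕ 0ℓ) (j : ℕ) : Set where
  constructor summary
  field
    bound : ∀ {w} → S w → once (φ w) ≤ j
    unique : odd j ≡ true → ∃ λ u → S u × once (φ u) ≡ j × (∀ {w} → S w → once (φ w) ≡ j → w ≡ u)

open Summary

data ⊕-View (x y : ℕ) : ℕ → Set where
  tie   : x ≡ y → odd x ≡ true → ⊕-View x y (suc x)
  tie′  : x ≡ y → odd x ≡ false → ⊕-View x y x
  left  : y < x → ⊕-View x y x
  right : x < y → ⊕-View x y y

⊕-view : ∀ x y → ⊕-View x y (x ⊕ y)
⊕-view x y with x ≡ᵇ y in e | odd x in o | x <ᵇ y in l
... | true  | true  | _     = tie (≡ᵇ⇒≡ x y (subst T (sym e) _)) o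
... | true  | false | true  = right (<ᵇ⇒< x y (subst T (sym l) _))
... | true  | false | false = tie′ (≡ᵇ⇒≡ x y (subst T (sym e) _)) o
... | false | _     | true  = right (<ᵇ⇒< x y (subst T (sym l) _))
... | false | _     | false = left (≤∧≢⇒< (≮⇒≥ λ x<y → subst T l (<⇒<ᵇ x<y))
                             λ y≡x → subst T e (≡⇒≡ᵇ x y (sym y≡x)))

-- Equal observations give an even result, for which a bound is enough. If one observation is
-- larger, every vertex of the other set lies strictly below it and cannot compete with its unique
-- top vertex.
Summary-∪ : ∀ {φ S S′ x y} → Summary φ S x → Summary φ S′ y → Summary φ (S ∪ S′) (x ⊕ y)
Summary-∪ {φ} {S} {S′} {x} {y} p q with x ⊕ y | ⊕-view x y
... | _ | tie x≡y o = summary [ (λ s → m≤n⇒m≤1+n (bound p s))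
                        , (λ s → m≤n⇒m≤1+n (≤-trans (bound q s) (≤-reflexive (sym x≡y)))) ]
  λ o′ → contradiction (trans (sym o′) (cong not o)) λ ()
... | _ | tie′ x≡y o = summary [ bound p , (λ s → ≤-trans (bound q s) (≤-reflexive (sym x≡y))) ]
  λ o′ → contradiction (trans (sym o′) o) λ ()
... | _ | left y<x = summary [ bound p , (λ s → ≤-trans (bound q s) (<⇒≤ y<x)) ]
  λ o → let u , Su , e , un = unique p o in
    u , inj₁ Su , e , λ { (inj₁ s) e → un s e
                        ; (inj₂ s) e → ⊥-elim (<⇒≱ y<x (subst (_≤ y) e (bound q s))) }
... | _ | right x<y = summary [ (λ s → ≤-trans (bound p s) (<⇒≤ x<y)) , bound q ]
  λ o → let u , Su , e , un = unique q o in
    u , inj₂ Su , e , λ { (inj₁ s) e → ⊥-elim (<⇒≱ x<y (subst (_≤ x) e (bound p s)))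
                        ; (inj₂ s) e → un s e }

Summary-none : ∀ {φ S} → Summary φ S 0 → ∀ {w} → ¬ S w
Summary-none p s with () ← bound p s

Summary-resp : ∀ {φ ψ S S′ j} → (∀ {w} → S w → S′ w) → (∀ {w} → S′ w → S w) →
  (∀ {w} → S w → φ w ≡ ψ w) → Summary φ S j → Summary ψ S′ j
Summary-resp {j = j} to from eq p = summary
  (λ s → subst (λ c → once c ≤ j) (eq (from s)) (bound p (from s)))
  λ o → let u , Su , e , un = unique p o in
    u , to Su , trans (cong once (sym (eq Su))) e , λ s e′ → un (from s) (trans (cong once (eq (from s))) e′)

Summary-singleton : ∀ {φ u} → Summary φ (_≡ u) (once (φ u))
Summary-singleton = summary (λ { refl → ≤-refl }) λ _ → _ , refl , refl , λ w≡u _ → w≡u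

data Neighbourhood : Set where
  open′ closed′ : Neighbourhood

-- For closed neighbourhoods a vertex only records the neighbours whose colour is at least its own.
Counts : Neighbourhood → ℕ → ℕ → Set
Counts open′   c d = ⊤
Counts closed′ c d = c ≤ d

-- In the closed case a neighbour of the vertex's own colour ties with the vertex itself, so that
-- colour is lost as a unique maximum from the start. Recording `many d` at once, rather than
-- `once d`, avoids a distinction without consequences.
contrib : Neighbourhood → ℕ → ℕ → ℕ
contrib open′   c d = once d
contrib closed′ c d = if d <ᵇ c then 0 else if d ≡ᵇ c then many d else once d

-- In the closed case there are two ways to succeed: no neighbour reaches the vertex's own colour,
-- so that the vertex itself is the unique maximum, or a strictly larger colour occurs at exactly
-- one neighbour.
ok : Neighbourhood → ℕ → ℕ → Bool
ok open′   c j = odd j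
ok closed′ c j = (j ≡ᵇ 0) ∨ (odd j ∧ (once c <ᵇ j))

Summary-contrib : ∀ 𝓝 {φ u} c → Summary φ (λ w → w ≡ u × Counts 𝓝 c (φ w)) (contrib 𝓝 c (φ u))
Summary-contrib open′ c = Summary-resp (_, _) proj₁ (λ _ → refl) Summary-singleton
Summary-contrib closed′ {φ} {u} c with φ u <ᵇ c in l | φ u ≡ᵇ c
... | true | _ = summary (λ { (refl , c≤d) → contradiction c≤d (<⇒≱ (<ᵇ⇒< _ _ (subst T (sym l) _))) }) λ ()
... | false | true = summary (λ { (refl , _) → n≤1+n _ }) λ o →
  contradiction (trans (sym o) (cong not (odd-once (φ u)))) λ ()
... | false | false = Summary-resp
  (λ { refl → refl , ≮⇒≥ (λ lt → subst T l (<⇒<ᵇ lt)) }) proj₁ (λ _ → refl) Summary-singleton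

-- Colourings of intervals

-- The colour c of an end of an interval and its observation j < 10, encoded as 10 c + j.
Side : Set
Side = ℕ

colour seen : Side → ℕ
colour s = s / 10
seen s = s % 10

Within : ℕ → ℕ → Rel ℕ 0ℓ → Set
Within a b D = ∀ {v w} → D v w → (a ≤ v × v ≤ b) × (a ≤ w × w ≤ b)

Chord : ℕ → ℕ → Rel ℕ 0ℓ
Chord a b v w = (v ≡ a × w ≡ b) ⊎ (v ≡ b × w ≡ a)

-- A set of pairs of sides: next to each side at one end, the sides it occurs with at the other end.
Type : Set
Type = List (Side × List Side)

_∋_,_ : Type → Side → Side → Set
τ ∋ x , y = ∃ λ ys → (x , ys) ∈ τ × y ∈ ys

_at_ : Type → Side → List Side
[]              at x = []
((y , zs) ∷ τ) at x = if x ≡ᵇ y then zs else τ at x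

at⇒∋ : ∀ τ {x y} → y ∈ τ at x → τ ∋ x , y
at⇒∋ ((x′ , ys) ∷ τ) {x} y∈ with x ≡ᵇ x′ in e
... | true with refl ← ≡ᵇ⇒≡ x x′ (subst T (sym e) tt) = ys , here refl , y∈
... | false = let ys , row , y∈ys = at⇒∋ τ y∈ in ys , there row , y∈ys

T-∧⁻ : ∀ {x y} → T (x ∧ y) → T x × T y
T-∧⁻ = Equivalence.to T-∧

any-find : ∀ {A : Set} (f : A → Bool) xs → T (any f xs) → ∃ λ x → x ∈ xs × T (f x)
any-find f xs t = find (any⁻ f xs t)

all-lookup : ∀ {A : Set} (f : A → Bool) {xs x} → T (all f xs) → x ∈ xs → T (f x)
all-lookup f {xs} t = All.lookup (all⁺ f xs t)

any-drop : ∀ {A : Set} (f : A → Bool) n xs → T (any f (drop n xs)) → ∃ λ x → x ∈ xs × T (f x)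
any-drop f zero xs t = any-find f xs t
any-drop f (suc n) (x ∷ xs) t = let y , y∈xs , fy = any-drop f n xs t in y , there y∈xs , fy

module Certificate (𝓝 : Neighbourhood) (k : ℕ) where

  Seen : (ℕ → ℕ) → Rel ℕ 0ℓ → ℕ → Pred ℕ 0ℓ
  Seen φ D v w = D v w × Counts 𝓝 (φ v) (φ w)

  Satisfied : (ℕ → ℕ) → Rel ℕ 0ℓ → ℕ → Set
  Satisfied φ D v = ∃ λ j → Summary φ (Seen φ D v) j × ok 𝓝 (φ v) j ≡ true

  -- Inner vertices must be satisfied already, because the intervals considered leave them no
  -- neighbours outside; the ends may still gain neighbours, so for them only the observations are
  -- kept. The colouring is total and bounded everywhere, so values outside the interval need no
  -- attention.
  record Realised (D : Rel ℕ 0ℓ) (a b : ℕ) (s t : Side) : Set where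
    field
      φ       : ℕ → ℕ
      bounded : ∀ v → φ v < k
      colourˡ   : φ a ≡ colour s
      colourʳ  : φ b ≡ colour t
      seenˡ   : Summary φ (Seen φ D a) (seen s)
      seenʳ  : Summary φ (Seen φ D b) (seen t)
      inner   : ∀ {v} → a < v → v < b → Satisfied φ D v

  Realised-resp : ∀ {D D′ a b s t} → (∀ {v w} → D v w → D′ v w) → (∀ {v w} → D′ v w → D v w) →
    Realised D a b s t → Realised D′ a b s t
  Realised-resp {D} {D′} to from R = record
    { φ = φ ; bounded = bounded ; colourˡ = colourˡ ; colourʳ = colourʳ
    ; seenˡ = transport seenˡ ; seenʳ = transport seenʳ
    ; inner = λ p q → let j , S , o = inner p q in j , transport S , o }
    where
    open Realised R
    transport : ∀ {v j} → Summary φ (Seen φ D v) j → Summary φ (Seen φ D′ v) j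
    transport = Summary-resp (map₁ to) (map₁ from) (λ _ → refl)

  -- Only m has neighbours in both pieces. It becomes an inner vertex, so its combined observation
  -- must be `ok` now; every other vertex keeps the observation it had in its own piece.
  Realised-glue : ∀ {D₁ D₂ a m b s u u′ t} → a < m → m < b → Within a m D₁ → Within m b D₂ →
    colour u ≡ colour u′ → ok 𝓝 (colour u) (seen u ⊕ seen u′) ≡ true →
    Realised D₁ a m s u → Realised D₂ m b u′ t → Realised (λ v w → D₁ v w ⊎ D₂ v w) a b s t
  Realised-glue {D₁} {D₂} {a} {m} {b} {s} {u} {u′} {t} a<m m<b in₁ in₂ same okm R₁ R₂ = record
    { φ = φ ; bounded = bounded
    ; colourˡ = trans (φ-left (<⇒≤ a<m)) R₁.colourˡ
    ; colourʳ = trans (φ-right (<⇒≤ m<b)) R₂.colourʳ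
    ; seenˡ = only₁ a<m R₁.seenˡ ; seenʳ = only₂ m<b R₂.seenʳ
    ; inner = inner }
    where
    module R₁ = Realised R₁
    module R₂ = Realised R₂
    D : Rel ℕ 0ℓ
    D v w = D₁ v w ⊎ D₂ v w
    φ : ℕ → ℕ
    φ v = if v <ᵇ m then R₁.φ v else R₂.φ v
    bounded : ∀ v → φ v < k
    bounded v with v <ᵇ m
    ... | true  = R₁.bounded v
    ... | false = R₂.bounded v
    φ-right : ∀ {v} → m ≤ v → φ v ≡ R₂.φ v
    φ-right {v} m≤v with v <ᵇ m in l
    ... | true  = contradiction m≤v (<⇒≱ (<ᵇ⇒< _ _ (subst T (sym l) _)))
    ... | false = refl
    φ-left : ∀ {v} → v ≤ m → φ v ≡ R₁.φ v
    φ-left {v} v≤m with v <ᵇ m in l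
    ... | true  = refl
    -- Only v = m is left. There the colour is taken from the right piece, and `same` makes the two
    -- pieces agree.
    ... | false with refl ← ≤-antisym v≤m (≮⇒≥ λ lt → subst T l (<⇒<ᵇ lt)) =
      trans R₂.colourˡ (trans (sym same) (sym R₁.colourʳ))
    part₁ : ∀ {v j} → v ≤ m → Summary R₁.φ (Seen R₁.φ D₁ v) j → Summary φ (Seen φ D₁ v) j
    part₁ v≤m = Summary-resp
      (λ (d , c) → d , subst₂ (Counts 𝓝) (sym (φ-left v≤m)) (sym (eq d)) c)
      (λ (d , c) → d , subst₂ (Counts 𝓝) (φ-left v≤m) (eq d) c)
      λ (d , _) → sym (eq d)
      where
      eq : ∀ {v w} → D₁ v w → φ w ≡ R₁.φ w
      eq d = φ-left (proj₂ (proj₂ (in₁ d)))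
    part₂ : ∀ {v j} → m ≤ v → Summary R₂.φ (Seen R₂.φ D₂ v) j → Summary φ (Seen φ D₂ v) j
    part₂ m≤v = Summary-resp
      (λ (d , c) → d , subst₂ (Counts 𝓝) (sym (φ-right m≤v)) (sym (eq d)) c)
      (λ (d , c) → d , subst₂ (Counts 𝓝) (φ-right m≤v) (eq d) c)
      λ (d , _) → sym (eq d)
      where
      eq : ∀ {v w} → D₂ v w → φ w ≡ R₂.φ w
      eq d = φ-right (proj₁ (proj₂ (in₂ d)))
    only₁ : ∀ {v j} → v < m → Summary R₁.φ (Seen R₁.φ D₁ v) j → Summary φ (Seen φ D v) j
    only₁ v<m S = Summary-resp (map₁ inj₁)
      (λ { (inj₁ d , c) → d , c ; (inj₂ d , _) → contradiction (proj₁ (proj₁ (in₂ d))) (<⇒≱ v<m) })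
      (λ _ → refl) (part₁ (<⇒≤ v<m) S)
    only₂ : ∀ {v j} → m < v → Summary R₂.φ (Seen R₂.φ D₂ v) j → Summary φ (Seen φ D v) j
    only₂ m<v S = Summary-resp (map₁ inj₂)
      (λ { (inj₂ d , c) → d , c ; (inj₁ d , _) → contradiction (proj₂ (proj₁ (in₁ d))) (<⇒≱ m<v) })
      (λ _ → refl) (part₂ (<⇒≤ m<v) S)
    inner : ∀ {v} → a < v → v < b → Satisfied φ D v
    inner {v} a<v v<b with <-cmp v m
    ... | tri< v<m _ _ = let j , S , o = R₁.inner a<v v<m in
      j , only₁ v<m S , trans (cong (λ c → ok 𝓝 c j) (φ-left (<⇒≤ v<m))) o
    ... | tri> _ _ m<v = let j , S , o = R₂.inner m<v v<b in
      j , only₂ m<v S , trans (cong (λ c → ok 𝓝 c j) (φ-right (<⇒≤ m<v))) o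
    ... | tri≈ _ refl _ = _ ,
      Summary-resp [ map₁ inj₁ , map₁ inj₂ ]
        (λ { (inj₁ d , c) → inj₁ (d , c) ; (inj₂ d , c) → inj₂ (d , c) }) (λ _ → refl)
        (Summary-∪ (part₁ ≤-refl R₁.seenʳ) (part₂ ≤-refl R₂.seenˡ)) ,
      trans (cong (λ c → ok 𝓝 c _) (trans (φ-left ≤-refl) R₁.colourʳ)) okm

  Realised-chord : ∀ {D a b s t s′ t′} → a < b →
    colour s′ ≡ colour s → colour t′ ≡ colour t →
    seen s′ ≡ seen s ⊕ contrib 𝓝 (colour s) (colour t) →
    seen t′ ≡ seen t ⊕ contrib 𝓝 (colour t) (colour s) →
    Realised D a b s t → Realised (λ v w → D v w ⊎ Chord a b v w) a b s′ t′
  Realised-chord {D} {a} {b} {s} {t} {s′} {t′} a<b cs ct es et R = record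
    { φ = φ ; bounded = bounded ; colourˡ = trans colourˡ (sym cs) ; colourʳ = trans colourʳ (sym ct)
    ; seenˡ = subst (Summary φ _) (trans (cong₂ (λ c d → seen s ⊕ contrib 𝓝 c d) colourˡ colourʳ) (sym es))
        (Summary-resp
          (λ { (inj₁ (d , c)) → inj₁ d , c ; (inj₂ (refl , c)) → inj₂ (inj₁ (refl , refl)) , c })
          (λ { (inj₁ d , c) → inj₁ (d , c) ; (inj₂ (inj₁ (_ , e)) , c) → inj₂ (e , c)
             ; (inj₂ (inj₂ (e , _)) , _) → contradiction e (<⇒≢ a<b) })
          (λ _ → refl) (Summary-∪ seenˡ (Summary-contrib 𝓝 (φ a))))
    ; seenʳ = subst (Summary φ _) (trans (cong₂ (λ c d → seen t ⊕ contrib 𝓝 c d) colourʳ colourˡ) (sym et))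
        (Summary-resp
          (λ { (inj₁ (d , c)) → inj₁ d , c ; (inj₂ (refl , c)) → inj₂ (inj₂ (refl , refl)) , c })
          (λ { (inj₁ d , c) → inj₁ (d , c) ; (inj₂ (inj₂ (_ , e)) , c) → inj₂ (e , c)
             ; (inj₂ (inj₁ (e , _)) , _) → contradiction (sym e) (<⇒≢ a<b) })
          (λ _ → refl) (Summary-∪ seenʳ (Summary-contrib 𝓝 (φ b))))
    ; inner = λ p q → let j , S , o = inner p q in j , Summary-resp (map₁ inj₁)
        (λ { (inj₁ d , c) → d , c ; (inj₂ (inj₁ (e , _)) , _) → contradiction (sym e) (<⇒≢ p)
           ; (inj₂ (inj₂ (e , _)) , _) → contradiction e (<⇒≢ q) }) (λ _ → refl) S , o }
    where
    open Realised R

  -- The finite checks that make up a certificate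

  joins : Side → Side → Bool
  joins u u′ = (colour u ≡ᵇ colour u′) ∧ ok 𝓝 (colour u) (seen u ⊕ seen u′)

  meets : List Side → List Side → Bool
  meets us us′ = any (λ u → any (joins u) us′) us

  chorded : Side → Side → Side → Bool
  chorded s t s′ = (colour s′ ≡ᵇ colour s) ∧ (seen s′ ≡ᵇ seen s ⊕ contrib 𝓝 (colour s) (colour t))

  -- Both pieces are indexed by their outer ends, so a row of p and a row of q list exactly the
  -- sides at m that have to be matched. `gluedChorded` looks for the sides s₁ and t₁ before the
  -- chord is added. It tests s₁ against the final side t instead of t₁, since a chord changes no
  -- colour.
  glued gluedChorded : Type → Type → Type → Bool
  glued p q r = all (λ (t , ss) → all (λ s → meets (p at s) (q at t)) ss) r
  gluedChorded p q l = all (λ (s , ts) → all (λ t →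
    any (λ (s₁ , us) → chorded s₁ t s ∧ any (λ (t₁ , us′) → chorded t₁ s t ∧ meets us us′) q) p) ts) l

  -- `colour s * 10` is the side of the same colour that has seen nothing. The bound k on colours is
  -- tested only here, because gluing and adding chords introduce no new colours.
  bareSide chordedSide : Side → Side → Bool
  bareSide s t = (seen s ≡ᵇ 0) ∧ (colour s <ᵇ k)
  chordedSide s t = chorded (colour s * 10) t s ∧ (colour s <ᵇ k)

  bare bareChord : Type → Bool
  bare = all λ (s , ts) → all (λ t → bareSide s t ∧ bareSide t s) ts
  bareChord = all λ (s , ts) → all (λ t → chordedSide s t ∧ chordedSide t s) ts

  -- This is inclusion of the second type in the first, up to the change of index from left to right
  -- end. A smaller set promises fewer colourings, so it is realised wherever the larger one is.
  weaker : Type → Type → Bool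
  weaker l = all λ (t , ss) → all (λ s → any (t ≡ᵇ_) (l at s)) ss

  isOpen : Bool
  isOpen = case 𝓝 of λ { open′ → true ; closed′ → false }

  isOpen⁻ : T isOpen → 𝓝 ≡ open′
  isOpen⁻ o = go 𝓝 refl o
    where
    go : ∀ 𝓝′ → 𝓝 ≡ 𝓝′ → T isOpen → 𝓝 ≡ open′
    go open′ e _ = e
    go closed′ refl ()

  -- One state per side is enough. That the middle vertex sees nothing is, for open neighbourhoods,
  -- a fact about the graph and not about the colouring, so a single realised state with observation
  -- 0 shows that the piece gives it no neighbour.
  loneMiddle : Type → Type → Bool
  loneMiddle p q = isOpen ∧
    any (λ (s , us) → any (λ u → seen u ≡ᵇ 0) us) p ∧
    any (λ (t , us′) → any (λ u′ → seen u′ ≡ᵇ 0) us′) q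

  final : Side → Bool
  final s = ok 𝓝 (colour s) (seen s)

  lone : Side → Side → Bool
  lone s t = isOpen ∧ ((seen s ≡ᵇ 0) ∨ (seen t ≡ᵇ 0))

  -- A hint (i , j) says where in R and L to look for the types covering the gluing of p and q.
  glueAll : List Type → List Type → Type → List Type → List (ℕ × ℕ) → Bool
  glueAll L R p []       hs = true
  glueAll L R p (q ∷ qs) [] = false
  glueAll L R p (q ∷ qs) ((i , j) ∷ hs) =
    (loneMiddle p q ∨ (any (glued p q) (drop i R) ∧ any (gluedChorded p q) (drop j L))) ∧ glueAll L R p qs hs

  glueAlls : List Type → List Type → List Type → List (List (ℕ × ℕ)) → Bool
  glueAlls L R [] hss = true
  glueAlls L R (p ∷ ps) [] = false
  glueAlls L R (p ∷ ps) (hs ∷ hss) = glueAll L R p R hs ∧ glueAlls L R ps hss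

  -- L covers the intervals spanned by a chord and the pairs of consecutive positions not joined by one.
  -- R covers all intervals, both with and without the chord spanning them.
  record Closed (L R : List Type) (hints : List (List (ℕ × ℕ))) : Set where
    field
      bares      : T (any bare L)
      bareChords : T (any bareChord L)
      weakens    : T (all (λ l → any (weaker l) R) L)
      glues      : T (glueAlls L R L hints)
      finals     : T (all (any λ (t , ss) → any (λ s → lone s t ∨ (final s ∧ final t)) ss) R)

  -- Soundness of certificates, by induction on intervals

  module _ {L R : List Type} {hints} (closed : Closed L R hints) {n : ℕ} {E : Rel ℕ 0ℓ}
    (E-sym : Symmetric E) (E? : B.Decidable E) (E< : ∀ {v w} → E v w → v < n)
    (E-irrefl : ∀ {v} → ¬ E v v)
    (planar : ∀ {a b c d} → a < c → c < b → b < d → E a b → E c d → ⊥)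
    (hasNbr : 𝓝 ≡ open′ → ∀ {v} → v < n → ∃ (E v))
    where

    -- Types in L are indexed by the side at the left end, types in R by the side at the right end.
    Realˡ Realʳ : Rel ℕ 0ℓ → ℕ → ℕ → Type → Set
    Realˡ D a b l = ∀ {s t} → l ∋ s , t → Realised D a b s t
    Realʳ D a b r = ∀ {s t} → r ∋ t , s → Realised D a b s t

    I I° : ℕ → ℕ → Rel ℕ 0ℓ
    I a b v w = E v w × (a ≤ v × v ≤ b) × (a ≤ w × w ≤ b)
    I° a b v w = I a b v w × ¬ Chord a b v w

    Sealed : ℕ → ℕ → Set
    Sealed a b = ∀ {v w} → a < v → v < b → E v w → a ≤ w × w ≤ b

    -- An interval can become a right piece whether or not its ends are joined, but a left piece of
    -- more than two vertices only when they are. Hence the type with the chord is sought in L, and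
    -- the one without it in R.
    Goal : ℕ → ℕ → Set
    Goal a b = (∃ λ r → r ∈ R × Realʳ (I° a b) a b r) × (E a b → ∃ λ l → l ∈ L × Realˡ (I a b) a b l)

    realise-bare : ∀ {D a s t} → (∀ {v w} → ¬ D v w) → T (bareSide s t) → T (bareSide t s) →
      Realised D a (suc a) s t
    realise-bare {D} {a} {s} {t} none bareₛ bareₜ = record
      { φ = φ ; bounded = bd ; colourˡ = colourˡ ; colourʳ = colourʳ
      ; seenˡ = subst (Summary φ _) (sym (≡ᵇ⇒≡ _ 0 (proj₁ (T-∧⁻ bareₛ)))) empty
      ; seenʳ = subst (Summary φ _) (sym (≡ᵇ⇒≡ _ 0 (proj₁ (T-∧⁻ bareₜ)))) empty
      ; inner = λ p q → contradiction p (<⇒≱ q) }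
      where
      φ : ℕ → ℕ
      φ v with v ≤? a
      ... | yes _ = colour s
      ... | no  _ = colour t
      bd : ∀ v → φ v < k
      bd v with v ≤? a
      ... | yes _ = <ᵇ⇒< _ k (proj₂ (T-∧⁻ bareₛ))
      ... | no  _ = <ᵇ⇒< _ k (proj₂ (T-∧⁻ bareₜ))
      colourˡ : φ a ≡ colour s
      colourˡ with a ≤? a
      ... | yes _ = refl
      ... | no ¬p = contradiction ≤-refl ¬p
      colourʳ : φ (suc a) ≡ colour t
      colourʳ with suc a ≤? a
      ... | yes p = contradiction p (<⇒≱ ≤-refl)
      ... | no ¬p = refl
      empty : ∀ {v} → Summary φ (Seen φ D v) 0
      empty = summary (λ (d , _) → contradiction d none) λ ()

    I°-suc : ∀ {a v w} → ¬ I° a (suc a) v w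
    I°-suc {a} ((e , (a≤v , v≤b) , (a≤w , w≤b)) , nc) with m≤n⇒m<n∨m≡n a≤v | m≤n⇒m<n∨m≡n a≤w
    ... | inj₂ refl | inj₂ refl = E-irrefl e
    ... | inj₁ a<v  | inj₁ a<w with refl ← ≤-antisym a<v v≤b | refl ← ≤-antisym a<w w≤b = E-irrefl e
    ... | inj₂ refl | inj₁ a<w = nc (inj₁ (refl , ≤-antisym w≤b a<w))
    ... | inj₁ a<v  | inj₂ refl = nc (inj₂ (≤-antisym v≤b a<v , refl))

    I-chord : ∀ {a b} → a < b → E a b → ∀ {v w} → I° a b v w ⊎ Chord a b v w → I a b v w
    I-chord a<b e (inj₁ (i , _)) = i
    I-chord a<b e (inj₂ (inj₁ (refl , refl))) = e , (≤-refl , <⇒≤ a<b) , (<⇒≤ a<b , ≤-refl)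
    I-chord a<b e (inj₂ (inj₂ (refl , refl))) = E-sym e , (<⇒≤ a<b , ≤-refl) , (≤-refl , <⇒≤ a<b)

    chord? : ∀ a b v w → Dec (Chord a b v w)
    chord? a b v w = ((v ≟ a) ×-dec (w ≟ b)) ⊎-dec ((v ≟ b) ×-dec (w ≟ a))

    I-split : ∀ {a b v w} → I a b v w → I° a b v w ⊎ Chord a b v w
    I-split {a} {b} {v} {w} i with chord? a b v w
    ... | yes c = inj₂ c
    ... | no ¬c = inj₁ (i , ¬c)

    chorded⁻ : ∀ {s t s′} → T (chorded s t s′) →
      colour s′ ≡ colour s × seen s′ ≡ seen s ⊕ contrib 𝓝 (colour s) (colour t)
    chorded⁻ ch = let c , e = T-∧⁻ ch in ≡ᵇ⇒≡ _ _ c , ≡ᵇ⇒≡ _ _ e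

    -- The checks compare with the sides after the chord has been added; as those have the colours
    -- of s and t, the equations can be rewritten to the form that `Realised-chord` expects.
    realise-chord : ∀ {a b s t s′ t′} → a < b → E a b → T (chorded s t′ s′) → T (chorded t s′ t′) →
      Realised (I° a b) a b s t → Realised (I a b) a b s′ t′
    realise-chord {s = s} {t} {s′} {t′} a<b e chₛ chₜ r =
      let cs , es = chorded⁻ {s} {t′} {s′} chₛ
          ct , et = chorded⁻ {t} {s′} {t′} chₜ
      in Realised-resp (I-chord a<b e) I-split (Realised-chord a<b cs ct
        (trans es (cong (λ c → seen s ⊕ contrib 𝓝 (colour s) c) ct))
        (trans et (cong (λ c → seen t ⊕ contrib 𝓝 (colour t) c) cs)) r)

    weaker⁻ : ∀ r l {s t} → T (weaker l r) → r ∋ t , s → l ∋ s , t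
    weaker⁻ r l {s} {t} w (ss , col , s∈ss) =
      let t′ , t′∈ , e = any-find (t ≡ᵇ_) (l at s)
            (all-lookup (λ s → any (t ≡ᵇ_) (l at s)) (all-lookup _ w col) s∈ss)
      in subst (l ∋ s ,_) (sym (≡ᵇ⇒≡ t t′ e)) (at⇒∋ l t′∈)

    weakened : ∀ {l} → l ∈ L → ∃ λ r → r ∈ R × (∀ {s t} → r ∋ t , s → l ∋ s , t)
    weakened {l} l∈L =
      let r , r∈R , w = any-find (weaker l) R
            (all-lookup (λ l → any (weaker l) R) (Closed.weakens closed) l∈L)
      in r , r∈R , weaker⁻ r l w

    bareType : ∃ λ l → l ∈ L × (∀ {D a} → (∀ {v w} → ¬ D v w) → Realˡ D a (suc a) l)
    bareType = let l , l∈L , bs = any-find bare L (Closed.bares closed) in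
      l , l∈L , λ { none (ts , row , t∈ts) →
        let bₛ , bₜ = T-∧⁻ (all-lookup _ (all-lookup _ bs row) t∈ts) in realise-bare none bₛ bₜ }

    -- When ab is an edge, the type comes from L and is weakened into R; in this way R is closed
    -- under adding chords although only L is checked for it.
    whole : ∀ {a b} → Goal a b → ∃ λ r → r ∈ R × Realʳ (I a b) a b r
    whole {a} {b} ((r , r∈R , real) , chord) with E? a b
    ... | yes e = let l , l∈L , real = chord e
                      r , r∈R , sub = weakened l∈L in
                  r , r∈R , λ st∈r → real (sub st∈r)
    ... | no ¬e = r , r∈R , λ st∈r → Realised-resp proj₁
                    (λ i → i , λ { (inj₁ (refl , refl)) → ¬e (proj₁ i)
                             ; (inj₂ (refl , refl)) → ¬e (E-sym (proj₁ i)) })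
                    (real st∈r)

    -- Splitting [a , b] at the last neighbour of a before b, no edge but ab passes over the splitting point.
    Pivot : ℕ → ℕ → ℕ → Set
    Pivot a b m = a < m × m < b × (E a m ⊎ m ≡ suc a) × (∀ {v} → m < v → v < b → ¬ E a v)

    pivot : ∀ a d → ∃ (Pivot a (2 + (d + a)))
    -- The search descends from b - 1 and falls back on a + 1, which is a valid splitting point even
    -- when it is not a neighbour of a: no vertex lies between a and m, so no edge can start there
    -- and pass over m.
    pivot a zero = suc a , ≤-refl , ≤-refl , inj₂ refl ,
      λ m<v v<b → contradiction m<v (<⇒≱ v<b)
    pivot a (suc d) with E? a (suc (suc (d + a)))
    ... | yes e = _ , s≤s (m≤n⇒m≤1+n (m≤n+m a d)) , ≤-refl , inj₁ e ,
      λ m<v v<b → contradiction m<v (<⇒≱ v<b)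
    ... | no ¬e = let m , a<m , m<b , e , none = pivot a d in
      m , a<m , m<n⇒m<1+n m<b , e , λ m<v v<b ev →
        [ (λ v<b′ → none m<v v<b′ ev) , (λ { refl → ¬e ev }) ] (m≤n⇒m<n∨m≡n (s≤s⁻¹ v<b))

    pivot′ : ∀ {a b} → suc a < b → ∃ (Pivot a b)
    pivot′ {a} {b} lt = subst (λ b → ∃ (Pivot a b))
      (trans (cong (2 +_) (+-comm (b ∸ (2 + a)) a)) (m+[n∸m]≡n lt)) (pivot a (b ∸ (2 + a)))

    module Split {a b m} (sealed : Sealed a b) (piv : Pivot a b m) where
      a<m = proj₁ piv
      m<b = proj₁ (proj₂ piv)

      -- An edge over m from a must end at b, since m is the last neighbour of a before b. One from
      -- a vertex strictly between a and m would cross the edge am; if m is a + 1, there is no such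
      -- vertex.
      no-jump : ∀ {v w} → E v w → a ≤ v → v < m → m < w → w ≤ b → v ≡ a × w ≡ b
      no-jump {v} {w} e a≤v v<m m<w w≤b with m≤n⇒m<n∨m≡n a≤v
      ... | inj₂ refl = refl ,
        [ (λ w<b → contradiction e (proj₂ (proj₂ (proj₂ piv)) m<w w<b)) , (λ w≡b → w≡b) ] (m≤n⇒m<n∨m≡n w≤b)
      ... | inj₁ a<v with proj₁ (proj₂ (proj₂ piv))
      ...   | inj₁ eam = ⊥-elim (planar a<v v<m m<w eam e)
      ...   | inj₂ refl = contradiction a<v (<⇒≱ v<m)

      split : ∀ {v w} → I° a b v w → I a m v w ⊎ I m b v w
      split {v} {w} ((e , (a≤v , v≤b) , (a≤w , w≤b)) , nc) with v ≤? m | w ≤? m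
      ... | yes v≤m | yes w≤m = inj₁ (e , (a≤v , v≤m) , (a≤w , w≤m))
      ... | no v≰m | no w≰m = inj₂ (e , (<⇒≤ (≰⇒> v≰m) , v≤b) , (<⇒≤ (≰⇒> w≰m) , w≤b))
      ... | yes v≤m | no w≰m with m≤n⇒m<n∨m≡n v≤m
      ...   | inj₂ refl = inj₂ (e , (≤-refl , v≤b) , (<⇒≤ (≰⇒> w≰m) , w≤b))
      ...   | inj₁ v<m = ⊥-elim (nc (inj₁ (no-jump e a≤v v<m (≰⇒> w≰m) w≤b)))
      split {v} {w} ((e , (a≤v , v≤b) , (a≤w , w≤b)) , nc) | no v≰m | yes w≤m with m≤n⇒m<n∨m≡n w≤m
      ...   | inj₂ refl = inj₂ (e , (<⇒≤ (≰⇒> v≰m) , v≤b) , (≤-refl , w≤b))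
      ...   | inj₁ w<m = ⊥-elim (nc (inj₂ (swap (no-jump (E-sym e) a≤w w<m (≰⇒> v≰m) v≤b))))

      unsplit : ∀ {v w} → I a m v w ⊎ I m b v w → I° a b v w
      unsplit (inj₁ (e , (a≤v , v≤m) , (a≤w , w≤m))) =
        (e , (a≤v , ≤-trans v≤m (<⇒≤ m<b)) , (a≤w , ≤-trans w≤m (<⇒≤ m<b))) ,
        λ { (inj₁ (_ , refl)) → contradiction w≤m (<⇒≱ m<b)
          ; (inj₂ (refl , _)) → contradiction v≤m (<⇒≱ m<b) }
      unsplit (inj₂ (e , (m≤v , v≤b) , (m≤w , w≤b))) =
        (e , (≤-trans (<⇒≤ a<m) m≤v , v≤b) , (≤-trans (<⇒≤ a<m) m≤w , w≤b)) ,
        λ { (inj₁ (refl , _)) → contradiction m≤v (<⇒≱ a<m)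
          ; (inj₂ (_ , refl)) → contradiction m≤w (<⇒≱ a<m) }

      inside : ∀ {v w} → a < v → v < b → E v w → I a m v w ⊎ I m b v w
      inside a<v v<b e = split ((e , (<⇒≤ a<v , <⇒≤ v<b) , sealed a<v v<b e) ,
        λ { (inj₁ (refl , _)) → contradiction ≤-refl (<⇒≱ a<v)
          ; (inj₂ (refl , _)) → contradiction ≤-refl (<⇒≱ v<b) })

      sealed₁ : Sealed a m
      sealed₁ a<v v<m e with inside a<v (<-trans v<m m<b) e
      ... | inj₁ (_ , _ , q) = q
      ... | inj₂ (_ , (m≤v , _) , _) = contradiction m≤v (<⇒≱ v<m)

      sealed₂ : Sealed m b
      sealed₂ m<v v<b e with inside (<-trans a<m m<v) v<b e
      ... | inj₂ (_ , _ , q) = q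
      ... | inj₁ (_ , (_ , v≤m) , _) = contradiction v≤m (<⇒≱ m<v)

    -- Only the empty set has observation 0, and in the open case every neighbour is counted, so
    -- this end has no neighbour at all within the piece.
    unseenʳ : ∀ {D a b s t} → 𝓝 ≡ open′ → seen t ≡ 0 → Realised D a b s t → ∀ {w} → ¬ D b w
    unseenʳ refl t0 r d = Summary-none (subst (Summary φ _) t0 seenʳ) (d , tt) where open Realised r

    unseenˡ : ∀ {D a b s t} → 𝓝 ≡ open′ → seen s ≡ 0 → Realised D a b s t → ∀ {w} → ¬ D a w
    unseenˡ refl s0 r d = Summary-none (subst (Summary φ _) s0 seenˡ) (d , tt) where open Realised r

    bareAt : ∀ s {t} → T (colour s <ᵇ k) → T (bareSide (colour s * 10) t)
    bareAt s s<k = Equivalence.from T-∧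
      ( ≡⇒≡ᵇ _ 0 (m*n%n≡0 (colour s) 10)
      , subst (λ c → T (c <ᵇ k)) (sym (m*n/n≡m (colour s) 10)) s<k)

    loneMiddle⁻ : ∀ {p q} → T (loneMiddle p q) → 𝓝 ≡ open′ ×
      T (any (λ (s , us) → any (λ u → seen u ≡ᵇ 0) us) p) ×
      T (any (λ (t , us′) → any (λ u′ → seen u′ ≡ᵇ 0) us′) q)
    loneMiddle⁻ lm = let o , l = T-∧⁻ {isOpen} lm in isOpen⁻ o , T-∧⁻ l

    glueAll⁻ : ∀ p qs hs {q} → T (glueAll L R p qs hs) → q ∈ qs →
      T (loneMiddle p q) ⊎ (∃ λ r → r ∈ R × T (glued p q r)) × (∃ λ l → l ∈ L × T (gluedChorded p q l))
    glueAll⁻ p (q ∷ qs) ((i , j) ∷ hs) g (here refl)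
      with Equivalence.to (T-∨ {loneMiddle p q}) (proj₁ (T-∧⁻ g))
    ... | inj₁ lm = inj₁ lm
    ... | inj₂ gl = let g₁ , g₂ = T-∧⁻ gl in inj₂ (any-drop _ i R g₁ , any-drop _ j L g₂)
    glueAll⁻ p (q ∷ qs) ((i , j) ∷ hs) g (there q∈) = glueAll⁻ p qs hs (proj₂ (T-∧⁻ {loneMiddle p q ∨ _} g)) q∈

    glueAlls⁻ : ∀ ps hss {p q} → T (glueAlls L R ps hss) → p ∈ ps → q ∈ R →
      T (loneMiddle p q) ⊎ (∃ λ r → r ∈ R × T (glued p q r)) × (∃ λ l → l ∈ L × T (gluedChorded p q l))
    glueAlls⁻ (p ∷ ps) (hs ∷ hss) g (here refl) q∈R = glueAll⁻ p R hs (proj₁ (T-∧⁻ g)) q∈R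
    glueAlls⁻ (p ∷ ps) (hs ∷ hss) g (there p∈) q∈R = glueAlls⁻ ps hss (proj₂ (T-∧⁻ {glueAll L R p R hs} g)) p∈ q∈R

    glues⁻ : ∀ {p q} → p ∈ L → q ∈ R →
      T (loneMiddle p q) ⊎ (∃ λ r → r ∈ R × T (glued p q r)) × (∃ λ l → l ∈ L × T (gluedChorded p q l))
    glues⁻ = glueAlls⁻ L _ (Closed.glues closed)

    -- Induction on a bound f for the length, as both pieces of a split are strictly shorter. Being
    -- sealed passes to both pieces because no edge but ab passes over m, and ab touches no inner
    -- vertex.
    interval : ∀ f {a b} → b ∸ a ≤ f → a < b → b < n → Sealed a b → Goal a b
    interval zero {a} {b} le a<b = contradiction (m∸n≡0⇒m≤n (n≤0⇒n≡0 le)) (<⇒≱ a<b)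
    interval (suc f) {a} {b} le a<b b<n sealed with m≤n⇒m<n∨m≡n a<b
    ... | inj₂ refl =
        (let l , l∈L , real = bareType
             r , r∈R , sub = weakened l∈L in
         r , r∈R , λ st∈r → real I°-suc (sub st∈r))
      , λ e → let l , l∈L , bs = any-find bareChord L (Closed.bareChords closed) in
          l , l∈L , λ {s} {t} (ts , row , t∈ts) →
            let okₛ , okₜ = T-∧⁻ {chordedSide s t}
                  (all-lookup (λ t → chordedSide s t ∧ chordedSide t s) (all-lookup _ bs row) t∈ts)
                chₛ , s<k = T-∧⁻ {chorded (colour s * 10) t s} okₛ
                chₜ , t<k = T-∧⁻ {chorded (colour t * 10) s t} okₜ
            in realise-chord {s = colour s * 10} {colour t * 10} a<b e chₛ chₜ
                 (realise-bare I°-suc (bareAt s {colour t * 10} s<k) (bareAt t {colour s * 10} t<k))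
    ... | inj₁ lt with pivot′ lt
    ...   | m , piv = case
      where
      open Split sealed piv
      leftPart : ∃ λ l → l ∈ L × Realˡ (I a m) a m l
      leftPart with E? a m
      -- A left piece spanned by the edge am has a type in L, by the second half of the induction
      -- hypothesis. Otherwise m is a + 1 and the bare type applies.
      ... | yes e = proj₂ (interval f
        (s≤s⁻¹ (≤-trans (∸-monoˡ-< m<b (<⇒≤ a<m)) le)) a<m (<-trans m<b b<n) sealed₁) e
      ... | no ¬e with proj₁ (proj₂ (proj₂ piv))
      ...   | inj₁ e = contradiction e ¬e
      ...   | inj₂ refl = let l , l∈L , real = bareType in
        l , l∈L , real
          (λ i → I°-suc (i , λ { (inj₁ (refl , refl)) → ¬e (proj₁ i)
                          ; (inj₂ (refl , refl)) → ¬e (E-sym (proj₁ i)) }))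
      rightPart : ∃ λ r → r ∈ R × Realʳ (I m b) m b r
      rightPart = whole (interval f (s≤s⁻¹ (≤-trans (∸-monoʳ-< a<m (<⇒≤ m<b)) le)) m<b b<n sealed₂)
      case : Goal a b
      case with leftPart | rightPart
      ... | p , p∈L , realp | q , q∈R , realq with glues⁻ p∈L q∈R
      -- The exempted case: m has a neighbour, which by `inside` lies in one of the two pieces, but
      -- m sees nothing in either.
      ...   | inj₁ lm = let
          o , lone₁ , lone₂ = loneMiddle⁻ {p} {q} lm
          _ , row , lone₁′ = any-find _ p lone₁
          u , u∈us , u0 = any-find (λ u → seen u ≡ᵇ 0) _ lone₁′
          _ , col , lone₂′ = any-find _ q lone₂
          u′ , u′∈us , u′0 = any-find (λ u → seen u ≡ᵇ 0) _ lone₂′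
          _ , e = hasNbr o (<-trans m<b b<n)
        in ⊥-elim ([ unseenʳ o (≡ᵇ⇒≡ _ 0 u0) (realp (_ , row , u∈us))
                   , unseenˡ o (≡ᵇ⇒≡ _ 0 u′0) (realq (_ , col , u′∈us)) ]
                   (inside a<m m<b e))
      ...   | inj₂ ((r , r∈R , gl) , (l , l∈L , ch)) =
          (r , r∈R , λ {s} {t} (ss , col , s∈ss) → join (at⇒∋ p) (at⇒∋ q)
            (all-lookup (λ s → meets (p at s) (q at t)) (all-lookup _ gl col) s∈ss)) ,
          λ e → l , l∈L , λ {s} {t} (ts , row , t∈ts) → unglueChord e (all-lookup
            (λ t → any (λ (s₁ , us) → chorded s₁ t s ∧
              any (λ (t₁ , us′) → chorded t₁ s t ∧ meets us us′) q) p)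
            (all-lookup _ ch row) t∈ts)
        where
        join : ∀ {s t us us′} → (∀ {u} → u ∈ us → p ∋ s , u) → (∀ {u} → u ∈ us′ → q ∋ t , u) →
          T (meets us us′) → Realised (I° a b) a b s t
        join {us = us} {us′} inp inq meet =
          let u , u∈us , meet′ = any-find (λ u → any (joins u) us′) us meet
              u′ , u′∈us′ , j = any-find (joins u) us′ meet′
              c , o = T-∧⁻ {colour u ≡ᵇ colour u′} j
          in Realised-resp unsplit split
               (Realised-glue a<m m<b proj₂ proj₂ (≡ᵇ⇒≡ _ _ c) (Equivalence.to T-≡ o)
                 (realp (inp u∈us)) (realq (inq u′∈us′)))
        unglueChord : ∀ {s t} → E a b →
          T (any (λ (s₁ , us) → chorded s₁ t s ∧ any (λ (t₁ , us′) → chorded t₁ s t ∧ meets us us′) q) p) →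
          Realised (I a b) a b s t
        unglueChord {s} {t} e g =
          let (s₁ , us) , row , g₁ = any-find _ p g
              chₛ , g₂ = T-∧⁻ {chorded s₁ t s} g₁
              (t₁ , us′) , col , g₃ = any-find _ q g₂
              chₜ , meet = T-∧⁻ {chorded t₁ s t} g₃
          in realise-chord {s = s₁} {t₁} {s} {t} a<b e chₛ chₜ
               (join (λ u∈ → us , row , u∈) (λ u∈ → us′ , col , u∈) meet)

    Colouring : Set
    Colouring = ∃ λ φ → (∀ v → φ v < k) × (∀ v → v < n → Satisfied φ E v)

    finish : ∀ {b s t} → n ≡ suc b → ok 𝓝 (colour s) (seen s) ≡ true → ok 𝓝 (colour t) (seen t) ≡ true →
      Realised (I 0 b) 0 b s t → Colouring
    finish {b} refl okₛ okₜ R = φ , bounded , sat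
      where
      open Realised R
      full : ∀ {v} → Satisfied φ (I 0 b) v → Satisfied φ E v
      full (j , S , o) = j , Summary-resp (λ (i , c) → proj₁ i , c)
        (λ (e , c) → (e , (z≤n , s≤s⁻¹ (E< e)) , (z≤n , s≤s⁻¹ (E< (E-sym e)))) , c) (λ _ → refl) S , o
      sat : ∀ v → v < suc b → Satisfied φ E v
      sat zero _ = full (_ , seenˡ , trans (cong (λ c → ok 𝓝 c _) colourˡ) okₛ)
      sat (suc v) v<n with m≤n⇒m<n∨m≡n (s≤s⁻¹ v<n)
      ... | inj₁ v<b = full (inner (s≤s z≤n) v<b)
      ... | inj₂ refl = full (_ , seenʳ , trans (cong (λ c → ok 𝓝 c _) colourʳ) okₜ)

    colouring : ∀ {b} → n ≡ suc b → 0 < b → Colouring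
    colouring {b} refl 0<b with whole (interval b ≤-refl 0<b ≤-refl λ _ _ e → z≤n , s≤s⁻¹ (E< (E-sym e)))
    ... | r , r∈R , real with any-find _ r (all-lookup _ (Closed.finals closed) r∈R)
    ...   | (t , ss) , col , fin′ with any-find (λ s → lone s t ∨ (final s ∧ final t)) ss fin′
    ...     | s , s∈ss , fin with Equivalence.to (T-∨ {lone s t}) fin
    ...       | inj₂ okk = let okₛ , okₜ = T-∧⁻ {final s} okk in
          finish refl (Equivalence.to T-≡ okₛ) (Equivalence.to T-≡ okₜ) (real (ss , col , s∈ss))
    -- Here one end of the whole line sees nothing in the entire graph, so it would be isolated.
    ...       | inj₁ ln = let
          o , end = T-∧⁻ {isOpen} ln
          R = real (ss , col , s∈ss)
          _ , e₀ = hasNbr (isOpen⁻ o) {0} (s≤s z≤n)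
          _ , e₁ = hasNbr (isOpen⁻ o) {b} ≤-refl
        in ⊥-elim ([ (λ s0 → unseenˡ (isOpen⁻ o) (≡ᵇ⇒≡ _ 0 s0) R
                                       (e₀ , (z≤n , z≤n) , (z≤n , s≤s⁻¹ (E< (E-sym e₀)))))
                   , (λ t0 → unseenʳ (isOpen⁻ o) (≡ᵇ⇒≡ _ 0 t0) R
                                       (e₁ , (z≤n , ≤-refl) , (z≤n , s≤s⁻¹ (E< (E-sym e₁))))) ]
                   (Equivalence.to (T-∨ {seen s ≡ᵇ 0}) end))

-- From positions to graphs

nbhd : Neighbourhood → (G : Graph) → Vertex G → Pred (Vertex G) 0ℓ
nbhd open′   = N
nbhd closed′ = N[_]

once-mono-≤ : ∀ {c d} → c ≤ d → once c ≤ once d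
once-mono-≤ c≤d = s≤s (+-mono-≤ c≤d c≤d)

once-cancel-≤ : ∀ {c d} → once c ≤ once d → c ≤ d
once-cancel-≤ {c} {d} le = ≮⇒≥ λ d<c → <⇒≱ (s≤s (+-mono-≤-< (<⇒≤ d<c) d<c)) le

module Drawing (G : Graph) (pos : Permutation′ (order G)) (nc : NonCrossing G pos) where
  open Graph G using (Adj; adj?; irrefl) renaming (sym to Adj-sym)

  P : Vertex G → ℕ
  P v = toℕ (pos ⟨$⟩ʳ v)

  P-injective : ∀ {u v} → P u ≡ P v → u ≡ v
  P-injective e = trans (sym (inverseˡ pos))
    (trans (cong (pos ⟨$⟩ˡ_) (Fin.toℕ-injective e)) (inverseˡ pos))

  data E (i j : ℕ) : Set where
    edge : ∀ {u v} → P u ≡ i → P v ≡ j → Adj u v → E i j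

  E-sym : ∀ {i j} → E i j → E j i
  E-sym (edge p q a) = edge q p (Adj-sym a)

  E-irrefl : ∀ {i} → ¬ E i i
  E-irrefl (edge p q a) = irrefl (P-injective (trans p (sym q))) a

  E? : ∀ i j → Dec (E i j)
  E? i j = map′ (λ (u , v , p , q , a) → edge p q a) (λ { (edge p q a) → _ , _ , p , q , a })
    (Fin.any? λ u → Fin.any? λ v → (P u ≟ i) ×-dec (P v ≟ j) ×-dec adj? u v)

  E< : ∀ {i j} → E i j → i < order G
  E< (edge {u} refl _ _) = Fin.toℕ<n (pos ⟨$⟩ʳ u)

  planar : ∀ {a b c d} → a < c → c < b → b < d → E a b → E c d → ⊥
  planar p q r (edge refl refl e) (edge refl refl f) = nc e f (p , q , r)

  nbr : ∀ {v j} → E (P v) j → ∃ λ u → P u ≡ j × Adj v u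
  nbr {v} (edge {u = v′} p q a) with refl ← P-injective {v′} {v} p = _ , q , a

  hasNbr : NoIsolated G → ∀ {i} → i < order G → ∃ (E i)
  hasNbr ni i<n = let v = pos ⟨$⟩ˡ fromℕ< i<n
                      u , a = ni v in
    P u , edge (trans (cong toℕ (inverseʳ pos)) (Fin.toℕ-fromℕ< i<n)) refl a

  module _ {k} {φ : ℕ → ℕ} (φ<k : ∀ v → φ v < k) where

    ψ : Coloring G k
    ψ v = fromℕ< (φ<k (P v))

    ψ≡ : ∀ v → toℕ (ψ v) ≡ φ (P v)
    ψ≡ v = Fin.toℕ-fromℕ< (φ<k (P v))

    ψ-≤ : ∀ {v w} → φ (P v) ≤ φ (P w) → ψ v Fin.≤ ψ w
    ψ-≤ {v} {w} = subst₂ _≤_ (sym (ψ≡ v)) (sym (ψ≡ w))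

    ψ-≡ : ∀ {v w} → ψ v ≡ ψ w → φ (P v) ≡ φ (P w)
    ψ-≡ {v} {w} e = trans (sym (ψ≡ v)) (trans (cong toℕ e) (ψ≡ w))

    UM : Pred (Vertex G) 0ℓ → Set
    UM S = ∃ λ c → IsMaxColorOf {G} ψ S c × OccursOnceIn {G} ψ S c

    dominant : ∀ {S} u → S u → (∀ {w} → S w → φ (P w) ≤ φ (P u)) →
      (∀ {w} → S w → φ (P w) ≡ φ (P u) → w ≡ u) → UM S
    dominant u Su max un = ψ u , ((u , Su , refl) , λ Sw → ψ-≤ (max Sw)) ,
      u , (Su , refl) , λ (Sw , e) → sym (un Sw (ψ-≡ e))

    um : ∀ 𝓝 v → Certificate.Satisfied 𝓝 k φ E (P v) → UM (nbhd 𝓝 G v)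
    um open′ v (j , S , o) with Summary.unique S o
    ... | _ , (a , _) , e , un with nbr a
    ...   | u , refl , a′ = dominant u a′
      (λ b → once-cancel-≤ (≤-trans (Summary.bound S (edge refl refl b , tt)) (≤-reflexive (sym e))))
      (λ b eq → P-injective (un (edge refl refl b , tt) (trans (cong once eq) e)))
    um closed′ v (j , S , o) with j ≡ᵇ 0 in j0 | odd j in oj | once (φ (P v)) <ᵇ j in lt
    -- No neighbour has a colour as large as that of v, so v is itself the unique maximum of its
    -- closed neighbourhood.
    ... | true | _ | _ = dominant v (inj₁ refl)
      (λ { (inj₁ refl) → ≤-refl ; (inj₂ a) → <⇒≤ (below a) })
      (λ { (inj₁ e) _ → e ; (inj₂ a) e → contradiction e (<⇒≢ (below a)) })
      where
      below : ∀ {w} → Adj v w → φ (P w) < φ (P v)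
      below a = ≰⇒> λ le → Summary-none
        (subst (Summary φ _) (≡ᵇ⇒≡ j 0 (subst T (sym j0) tt)) S) (edge refl refl a , le)
    -- The top counted neighbour exceeds the colour of v, and the neighbours that were not counted
    -- lie below the colour of v, so neither v nor they can rival it.
    ... | false | true | true with Summary.unique S oj
    ...   | _ , (a , _) , e , un with nbr a
    ...     | u , refl , a′ = dominant u (inj₂ a′)
      (λ { (inj₁ refl) → <⇒≤ above ; (inj₂ b) → max b })
      (λ { (inj₁ refl) eq → contradiction eq (<⇒≢ above)
         ; (inj₂ b) eq → P-injective (un
             (edge refl refl b , ≤-trans (<⇒≤ above) (≤-reflexive (sym eq))) (trans (cong once eq) e)) })
      where
      above : φ (P v) < φ (P u)
      above = ≰⇒> λ le → <⇒≱
        (<ᵇ⇒< (once (φ (P v))) j (subst T (sym lt) tt)) (≤-trans (≤-reflexive (sym e)) (once-mono-≤ le))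
      max : ∀ {w} → Adj v w → φ (P w) ≤ φ (P u)
      max {w} b with φ (P v) ≤? φ (P w)
      ... | yes le = once-cancel-≤ (≤-trans (Summary.bound S (edge refl refl b , le)) (≤-reflexive (sym e)))
      ... | no nle = <⇒≤ (<-trans (≰⇒> nle) above)

um-colourable : ∀ 𝓝 {k L R hints} → Certificate.Closed 𝓝 k L R hints → 0 < k → ∀ G → Outerplanar G →
  (𝓝 ≡ open′ → NoIsolated G) → ∃ λ (φ : Coloring G k) → UniqueMaximum {G} φ (nbhd 𝓝 G)
um-colourable 𝓝 {k} closed 0<k G (pos , nc) ni = bySize (order G) refl
  where
  open Drawing G pos nc
  only : order G ≡ 1 → ∀ (u v : Vertex G) → u ≡ v
  only one u v = Fin.toℕ-injective (trans (z u) (sym (z v)))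
    where
    z : ∀ u → toℕ u ≡ 0
    z u = n<1⇒n≡0 (subst (toℕ u <_) one (Fin.toℕ<n u))
  single : ∀ 𝓝 → order G ≡ 1 → (𝓝 ≡ open′ → NoIsolated G) →
    ∃ λ (φ : Coloring G k) → UniqueMaximum {G} φ (nbhd 𝓝 G)
  single open′ one ni = (λ _ → fromℕ< 0<k) , λ v →
    let u , a = ni refl v in contradiction a (Graph.irrefl G (only one v u))
  single closed′ one _ = (λ _ → fromℕ< 0<k) , λ v →
    fromℕ< 0<k , ((v , inj₁ refl , refl) , λ _ → ≤-refl) , v , (inj₁ refl , refl) , λ {w} _ → only one v w
  bySize : ∀ n → n ≡ order G → ∃ λ (φ : Coloring G k) → UniqueMaximum {G} φ (nbhd 𝓝 G)
  bySize 0 e = (λ _ → fromℕ< 0<k) , λ v → contradiction (subst (toℕ v <_) (sym e) (Fin.toℕ<n v)) λ ()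
  bySize 1 e = single 𝓝 (sym e) ni
  bySize (suc (suc n)) e =
    let φ , φ<k , sat = Certificate.colouring 𝓝 k closed E-sym E? E< E-irrefl planar
          (λ o → hasNbr (ni o)) (sym e) (s≤s z≤n)
    in ψ φ<k , λ v → um φ<k 𝓝 v (sat (P v) (Fin.toℕ<n (pos ⟨$⟩ʳ v)))

-- Decidability and monotonicity of colourability

minimum : ∀ {P : Pred ℕ 0ℓ} → Decidable P → ∀ {k} → P k →
  ∃ λ m → IsMinimum P m × m ≤ k
minimum {P} P? {k} Pk with P? 0
... | yes P0 = 0 , (P0 , λ _ → z≤n) , z≤n
minimum {P} P? {zero} Pk | no ¬P0 = contradiction Pk ¬P0
minimum {P} P? {suc k} Pk | no ¬P0 with minimum {λ i → P (suc i)} (λ i → P? (suc i)) Pk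
... | m , (Pm , least) , m≤k =
  suc m , (Pm , λ { {zero} P0 → contradiction P0 ¬P0 ; {suc i} Pi → s≤s (least Pi) }) , s≤s m≤k

module _ {G : Graph} (nbhd : Vertex G → Pred (Vertex G) 0ℓ) where

  OccursOnce-resp : ∀ {k} {φ ψ : Coloring G k} → φ ≗ ψ →
    ∀ {v c} → OccursOnceIn {G} φ (nbhd v) c → OccursOnceIn {G} ψ (nbhd v) c
  OccursOnce-resp eq (u , (s , e) , un) = u , (s , trans (sym (eq u)) e) , λ {w} (t , f) → un (t , trans (eq w) f)

  ConflictFree-resp : ∀ {k} {φ ψ : Coloring G k} → φ ≗ ψ → ConflictFree {G} φ nbhd → ConflictFree {G} ψ nbhd
  ConflictFree-resp eq cf v = map₂ (OccursOnce-resp eq) (cf v)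

  UniqueMaximum-resp : ∀ {k} {φ ψ : Coloring G k} → φ ≗ ψ → UniqueMaximum {G} φ nbhd → UniqueMaximum {G} ψ nbhd
  UniqueMaximum-resp eq um v = let c , ((u , s , e) , max) , once = um v in
    c , ((u , s , trans (sym (eq u)) e) , λ {w} t → subst (Fin._≤ c) (eq w) (max t)) , OccursOnce-resp eq once

  UniqueMaximum⇒ConflictFree : ∀ {k} {φ : Coloring G k} → UniqueMaximum {G} φ nbhd → ConflictFree {G} φ nbhd
  UniqueMaximum⇒ConflictFree um v = map₂ proj₂ (um v)

  module _ {k k′} (k≤k′ : k ≤ k′) {φ : Coloring G k} where

    weakenColours : Coloring G k′
    weakenColours v = inject≤ (φ v) k≤k′

    OccursOnce-weaken : ∀ {v c} → OccursOnceIn {G} φ (nbhd v) c →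
      OccursOnceIn {G} weakenColours (nbhd v) (inject≤ c k≤k′)
    OccursOnce-weaken (u , (s , e) , un) = u , (s , cong (λ c → inject≤ c k≤k′) e) ,
      λ (t , f) → un (t , Fin.inject≤-injective k≤k′ k≤k′ _ _ f)

    ConflictFree-weaken : ConflictFree {G} φ nbhd → ConflictFree {G} weakenColours nbhd
    ConflictFree-weaken cf v = let c , once = cf v in inject≤ c k≤k′ , OccursOnce-weaken once

    UniqueMaximum-weaken : UniqueMaximum {G} φ nbhd → UniqueMaximum {G} weakenColours nbhd
    UniqueMaximum-weaken um v = let c , ((u , s , e) , max) , once = um v in
      inject≤ c k≤k′ , ((u , s , cong (λ c → inject≤ c k≤k′) e) ,
        λ {w} t → subst₂ _≤_ (sym (Fin.toℕ-inject≤ (φ w) k≤k′)) (sym (Fin.toℕ-inject≤ c k≤k′)) (max t)) ,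
      OccursOnce-weaken once

  module _ (nbhd? : ∀ v → Decidable (nbhd v)) where

    occursOnce? : ∀ {k} (φ : Coloring G k) v → Decidable (OccursOnceIn {G} φ (nbhd v))
    occursOnce? φ v c = Fin.any? λ u → here? u ×-dec
      map′ (λ f {w} → f w) (λ f w → f {w}) (Fin.all? λ w → here? w →-dec (u Fin.≟ w))
      where
      here? : Decidable (λ u → nbhd v u × φ u ≡ c)
      here? u = nbhd? v u ×-dec (φ u Fin.≟ c)

    conflictFree? : ∀ {k} (φ : Coloring G k) → Dec (ConflictFree {G} φ nbhd)
    conflictFree? φ = Fin.all? λ v → Fin.any? λ c → occursOnce? φ v c

    uniqueMaximum? : ∀ {k} (φ : Coloring G k) → Dec (UniqueMaximum {G} φ nbhd)
    uniqueMaximum? φ = Fin.all? λ v → Fin.any? λ c →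
      (Fin.any? (λ u → nbhd? v u ×-dec (φ u Fin.≟ c)) ×-dec
       map′ (λ f {u} → f u) (λ f u → f {u}) (Fin.all? λ u → nbhd? v u →-dec (φ u Fin.≤? c)))
      ×-dec occursOnce? φ v c

-- Colourings are enumerated through their codes in `Fin (k ^ order G)`. Decoding returns a
-- colouring only up to pointwise equality, which Q therefore has to respect.
coloring? : ∀ {G k} {Q : Coloring G k → Set} → (∀ {φ ψ} → φ ≗ ψ → Q φ → Q ψ) →
  (∀ φ → Dec (Q φ)) → Dec (∃ Q)
coloring? {G} {k} resp Q? = map′ (λ (i , q) → finToFun i , q)
  (λ (φ , q) → funToFin φ , resp (λ v → sym (Fin.finToFun-funToFin φ v)) q)
  (Fin.any? λ (i : Fin (k ^ order G)) → Q? (finToFun i))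

nbhd? : ∀ 𝓝 G v → Decidable (nbhd 𝓝 G v)
nbhd? open′   G v u = Graph.adj? G v u
nbhd? closed′ G v u = (u Fin.≟ v) ⊎-dec Graph.adj? G v u

CF-colourable UM-colourable : Neighbourhood → Graph → Pred ℕ 0ℓ
CF-colourable 𝓝 G k = ∃ λ (φ : Coloring G k) → ConflictFree {G} φ (nbhd 𝓝 G)
UM-colourable 𝓝 G k = ∃ λ (φ : Coloring G k) → UniqueMaximum {G} φ (nbhd 𝓝 G)

CF-colourable? : ∀ 𝓝 G k → Dec (CF-colourable 𝓝 G k)
CF-colourable? 𝓝 G k = coloring? {G} (ConflictFree-resp {G} (nbhd 𝓝 G)) (conflictFree? {G} (nbhd 𝓝 G) (nbhd? 𝓝 G))

UM-colourable? : ∀ 𝓝 G k → Dec (UM-colourable 𝓝 G k)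
UM-colourable? 𝓝 G k = coloring? {G} (UniqueMaximum-resp {G} (nbhd 𝓝 G)) (uniqueMaximum? {G} (nbhd 𝓝 G) (nbhd? 𝓝 G))

-- Graphs for the lower bounds

module Edges (n : ℕ) (es : List (ℕ × ℕ)) where

  Joined : ℕ → ℕ → Set
  Joined i j = (i , j) ∈ es ⊎ (j , i) ∈ es

  ascending? : Dec (All (λ (i , j) → i < j) es)
  ascending? = All.all? (λ (i , j) → i <? j) es

  uncrossed? : Dec (All (λ (a , b) → All (λ (c , d) → ¬ (a < c × c < b × b < d)) es) es)
  uncrossed? = All.all? (λ (a , b) → All.all? (λ (c , d) → ¬? ((a <? c) ×-dec (c <? b) ×-dec (b <? d))) es) es

  module _ {ascending : True ascending?} where

    graph : Graph
    graph = record
      { order  = n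
      ; Adj    = λ u v → Joined (toℕ u) (toℕ v)
      ; sym    = Sum.swap
      ; irrefl = λ { refl → [ loop , loop ] }
      ; adj?   = λ u v → ((toℕ u , toℕ v) ∈? es) ⊎-dec ((toℕ v , toℕ u) ∈? es)
      }
      where
      loop : ∀ {i} → ¬ (i , i) ∈ es
      loop e = <-irrefl refl (All.lookup (toWitness ascending) e)

    -- Vertices are numbered in the order of a drawing, so the identity serves as position. In an
    -- alternating pair both edges run upwards, hence occur in `es` as listed, and the test on the
    -- list is enough.
    outerplanar : {uncrossed : True uncrossed?} → Outerplanar graph
    outerplanar {uncrossed} = Permutation.id , λ ab cd (a<c , c<b , b<d) →
      All.lookup (All.lookup (toWitness uncrossed) (up (<-trans a<c c<b) ab)) (up (<-trans c<b b<d) cd)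
        (a<c , c<b , b<d)
      where
      up : ∀ {i j} → i < j → Joined i j → (i , j) ∈ es
      up i<j (inj₁ e) = e
      up i<j (inj₂ e) = contradiction (All.lookup (toWitness ascending) e) (<-asym i<j)

module Triangle = Edges 3 ((0 , 1) ∷ (0 , 2) ∷ (1 , 2) ∷ [])
module Bull = Edges 5 ((0 , 1) ∷ (1 , 2) ∷ (1 , 3) ∷ (2 , 3) ∷ (3 , 4) ∷ [])

-- Any two vertices form the neighbourhood of the third and must differ in colour, so three colours
-- are needed; the proof runs through all colourings.
triangle : ¬ CF-colourable open′ Triangle.graph 2
triangle = toWitnessFalse {a? = CF-colourable? open′ Triangle.graph 2} _

-- The pendant vertices 0 and 4 differ from 1 and 3 respectively. With two colours a closed
-- neighbourhood of four vertices must split as three and one, so 2 and 3 agree (seen from 1) and 1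
-- and 2 agree (seen from 3). Then 2 sees three vertices of one colour. The proof itself is
-- exhaustive.
bull : ¬ CF-colourable closed′ Bull.graph 2
bull = toWitnessFalse {a? = CF-colourable? closed′ Bull.graph 2} _

noIsolated? : ∀ G → Dec (NoIsolated G)
noIsolated? G = Fin.all? λ v → Fin.any? λ u → Graph.adj? G v u

module Fans = Edges 11
  ((0 , 1) ∷ (1 , 2) ∷ (2 , 3) ∷ (3 , 4) ∷ (5 , 6) ∷ (6 , 7) ∷ (7 , 8) ∷ (8 , 9) ∷
   (0 , 10) ∷ (1 , 10) ∷ (3 , 10) ∷ (4 , 10) ∷ (5 , 10) ∷ (6 , 10) ∷ (8 , 10) ∷ (9 , 10) ∷ [])

Peak : ∀ {d k} → Vec (Fin k) d → Set
Peak cs = ∃ λ i → ∀ j → j ≡ i ⊎ lookup cs j Fin.< lookup cs i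

peak? : ∀ {d k} (cs : Vec (Fin k) d) → Dec (Peak cs)
peak? cs = Fin.any? λ i → Fin.all? λ j → (j Fin.≟ i) ⊎-dec (lookup cs j Fin.<? lookup cs i)

Lists : ∀ {d} (G : Graph) → Vertex G → Vec (Vertex G) d → Set
Lists G v us = (∀ i → Graph.Adj G v (lookup us i)) ×
  (∀ u → Graph.Adj G v u → ∃ λ i → lookup us i ≡ u) ×
  (∀ i j → lookup us i ≡ lookup us j → i ≡ j)

lists? : ∀ {d} G v (us : Vec (Vertex G) d) → Dec (Lists G v us)
lists? G v us = Fin.all? (λ i → Graph.adj? G v (lookup us i)) ×-dec
  Fin.all? (λ u → Graph.adj? G v u →-dec Fin.any? λ i → lookup us i Fin.≟ u) ×-dec
  Fin.all? (λ i → Fin.all? λ j → (lookup us i Fin.≟ lookup us j) →-dec (i Fin.≟ j))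

-- This turns the condition at one vertex into one on a short vector of colours, so that the search
-- need not range over all 3^11 colourings of the fans. That `us` has no repetitions makes a unique
-- vertex a unique index.
peak : ∀ {d k} {G : Graph} {φ : Coloring G k} → UniqueMaximum {G} φ (N G) →
  ∀ v (us : Vec (Vertex G) d) → Lists G v us → Peak (Vec.map φ us)
peak {φ = φ} um v us (adj , complete , distinct) with um v
... | c , (_ , max) , u , (u∈ , refl) , un with complete u u∈
...   | i , refl = i , λ j → lower j (lookup us j Fin.≟ lookup us i)
  where
  lower : ∀ j → Dec (lookup us j ≡ lookup us i) → j ≡ i ⊎ lookup (Vec.map φ us) j Fin.< lookup (Vec.map φ us) i
  lower j (yes e) = inj₁ (distinct j i e)
  lower j (no ne) = inj₂ (subst₂ Fin._<_ (sym (lookup-map j φ us)) (sym (lookup-map i φ us))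
    (≤∧≢⇒< (max (adj j)) λ e → ne (sym (un (adj j , Fin.toℕ-injective e)))))

-- A path a b c d e in Fans.graph, whose vertices a, b, d, e are joined to the hub x.
Path : ∀ {k} → Fin k → (Fin k → Fin k → Fin k → Fin k → Set) → Set
Path {k} x P = ∀ b → Peak (b ∷ x ∷ []) → ∀ d → Peak (d ∷ x ∷ []) → Peak (b ∷ d ∷ []) →
  ∀ a c → Peak (a ∷ c ∷ x ∷ []) → ∀ e → Peak (c ∷ e ∷ x ∷ []) → P a b d e

-- Each condition is tested soon after its colours are fixed, which prunes the search before the
-- remaining vertices are coloured.
path? : ∀ {k} (x : Fin k) {P} → (∀ a b d e → Dec (P a b d e)) → Dec (Path x P)
path? x P? = Fin.all? λ b → peak? (b ∷ x ∷ []) →-dec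
  Fin.all? λ d → peak? (d ∷ x ∷ []) →-dec peak? (b ∷ d ∷ []) →-dec
  Fin.all? λ a → Fin.all? λ c → peak? (a ∷ c ∷ x ∷ []) →-dec
  Fin.all? λ e → peak? (c ∷ e ∷ x ∷ []) →-dec P? a b d e

-- The neighbourhoods of a, e and c make x, b and d pairwise distinct, so they take all three
-- colours. If x is not the top colour, then b or d has it in each path, and the hub sees it twice.
-- If x is the top colour, it is the maximum at b and at d, so a and e avoid it; b and d have the
-- two lower colours, and the hub sees the middle colour as its maximum at least twice. This is why
-- two paths are used.
hub : ∀ (x : Fin 3) → Path x λ a b d e → Path x λ a′ b′ d′ e′ →
  ¬ Peak (a ∷ b ∷ d ∷ e ∷ a′ ∷ b′ ∷ d′ ∷ e′ ∷ [])
hub = toWitness {a? = Fin.all? λ x → path? x λ a b d e → path? x λ a′ b′ d′ e′ →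
  ¬? (peak? (a ∷ b ∷ d ∷ e ∷ a′ ∷ b′ ∷ d′ ∷ e′ ∷ []))} _

fans : ¬ UM-colourable open′ Fans.graph 3
fans (φ , um) = hub (φ (# 10))
  -- Vertices 0 to 4 are a, b, c, d, e of one path and 5 to 9 those of the other; each `at` reads
  -- off the condition at the vertex named first.
  (φ (# 1)) (at (# 0) (# 1 ∷ # 10 ∷ [])) (φ (# 3)) (at (# 4) (# 3 ∷ # 10 ∷ [])) (at (# 2) (# 1 ∷ # 3 ∷ []))
  (φ (# 0)) (φ (# 2)) (at (# 1) (# 0 ∷ # 2 ∷ # 10 ∷ [])) (φ (# 4)) (at (# 3) (# 2 ∷ # 4 ∷ # 10 ∷ []))
  (φ (# 6)) (at (# 5) (# 6 ∷ # 10 ∷ [])) (φ (# 8)) (at (# 9) (# 8 ∷ # 10 ∷ [])) (at (# 7) (# 6 ∷ # 8 ∷ []))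
  (φ (# 5)) (φ (# 7)) (at (# 6) (# 5 ∷ # 7 ∷ # 10 ∷ [])) (φ (# 9)) (at (# 8) (# 7 ∷ # 9 ∷ # 10 ∷ []))
  (at (# 10) (# 0 ∷ # 1 ∷ # 3 ∷ # 4 ∷ # 5 ∷ # 6 ∷ # 8 ∷ # 9 ∷ []))
  where
  at : ∀ {d} v (us : Vec (Fin 11) d) {us! : True (lists? Fans.graph v us)} → Peak (Vec.map φ us)
  at v us {us!} = peak {G = Fans.graph} um v us (toWitness us!)

CF-weaken : ∀ 𝓝 G {k k′} → k ≤ k′ → CF-colourable 𝓝 G k → CF-colourable 𝓝 G k′
CF-weaken 𝓝 G k≤k′ (φ , cf) = _ , ConflictFree-weaken {G} (nbhd 𝓝 G) k≤k′ {φ} cf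

UM-weaken : ∀ 𝓝 G {k k′} → k ≤ k′ → UM-colourable 𝓝 G k → UM-colourable 𝓝 G k′
UM-weaken 𝓝 G k≤k′ (φ , um) = _ , UniqueMaximum-weaken {G} (nbhd 𝓝 G) k≤k′ {φ} um

UM-colourable⇒CF-colourable : ∀ 𝓝 G {k} → UM-colourable 𝓝 G k → CF-colourable 𝓝 G k
UM-colourable⇒CF-colourable 𝓝 G (φ , um) = φ , UniqueMaximum⇒ConflictFree {G} (nbhd 𝓝 G) {φ = φ} um

minimum-> : ∀ {P : Pred ℕ 0ℓ} {k m} → (∀ {i j} → i ≤ j → P i → P j) → ¬ P k → IsMinimum P m → k < m
minimum-> weaken ¬Pk (Pm , _) = ≰⇒> λ m≤k → ¬Pk (weaken m≤k Pm)

-- The certificates and the theorem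

-- Digits come out lowest first. The leading 1 serves as an end mark because 0 is a proper digit:
-- the side of colour 0 that has seen nothing, or the hint (0 , 0). Four colours and nine
-- observations give at most 36 sides, so 40 digits suffice for a row.
digits : (b : ℕ) .{{_ : NonZero b}} → ℕ → ℕ → List ℕ
digits b zero       n = []
digits b (suc fuel) n = if n ≡ᵇ 1 then [] else n % b ∷ digits b fuel (n / b)

-- The rows of a type are written as numbers in base 100: a leading digit 1, then the listed sides,
-- and the side they are listed for as the last digit.  Hints are written likewise in base 10000.
decodeType : List ℕ → Type
decodeType = map λ n → split (digits 100 40 n)
  where
  split : List ℕ → Side × List Side
  split []       = 0 , []
  split (x ∷ xs) = x , xs

decodeHints : ℕ → List (ℕ × ℕ)
decodeHints n = map (λ h → h / 100 , h % 100) (digits 10000 128 n)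

-- The certificates were found by computer search.
openLefts openRights : List Type
openLefts = map decodeType (
    (10101 ∷ 11103 ∷ 12105 ∷ 13107 ∷ 10311 ∷ 11313 ∷ 12315 ∷ 13317 ∷ 10521 ∷ 11523 ∷ 12525 ∷ 13527 ∷ 10731 ∷ 11733 ∷ 12735 ∷ 13737 ∷ [])
  ∷ (13020100000 ∷ 13020100010 ∷ 13020100020 ∷ 13020100030 ∷ [])
  ∷ (121110106 ∷ 13121110107 ∷ 12108 ∷ 123130316 ∷ 13323130317 ∷ 1150524 ∷ 12525 ∷ 13525150527 ∷ 1170734 ∷ 127170735 ∷ 13737 ∷ [])
  ∷ (1070601 ∷ 118171603 ∷ 128272405 ∷ 136353407 ∷ 1070611 ∷ 118171613 ∷ 128272415 ∷ 136353417 ∷ 108070621 ∷ 1171623 ∷ 128272525 ∷ 13527 ∷ 10731 ∷ 11733 ∷ 12735 ∷ 13737 ∷ [])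
  ∷ (10103 ∷ 11104 ∷ 121110105 ∷ 12106 ∷ 13121110107 ∷ 13108 ∷ 10313 ∷ 11314 ∷ 123130315 ∷ 12316 ∷ 13323130317 ∷ 10523 ∷ 11524 ∷ 125150525 ∷ 12526 ∷ 13525150527 ∷ 10733 ∷ 11734 ∷ 127170735 ∷ 13737 ∷ [])
  ∷ (107050301 ∷ 117151303 ∷ 127252305 ∷ 1353307 ∷ 107050411 ∷ 117151413 ∷ 127252415 ∷ 1353417 ∷ 107060521 ∷ 117161523 ∷ 1272525 ∷ 1363527 ∷ 1080731 ∷ 1181733 ∷ 1282735 ∷ 13737 ∷ [])
  ∷ (12724171606 ∷ 135342724171607 ∷ 13508 ∷ 12724070616 ∷ 135342724070617 ∷ 11716070624 ∷ 136351716070627 ∷ 118170734 ∷ 128271817080735 ∷ [])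
  ∷ (11203 ∷ 11304 ∷ 123221505 ∷ 12506 ∷ 1353332271707 ∷ 13708 ∷ 10312 ∷ 10413 ∷ 124230515 ∷ 12516 ∷ 1353433270717 ∷ 10522 ∷ 1150523 ∷ 11524 ∷ 1160625 ∷ 13635170727 ∷ 10732 ∷ 1170733 ∷ 11734 ∷ 127170735 ∷ 128180837 ∷ [])
  ∷ (125231513050306 ∷ 1353327252317151307050307 ∷ 13708 ∷ 1252313050316 ∷ 1353327252317151307050317 ∷ 1150524 ∷ 1351715070527 ∷ 1170734 ∷ 127170735 ∷ [])
  ∷ (1252322151306 ∷ 13533322723221715131207 ∷ 12508 ∷ 1252405040316 ∷ 13534332724230705040317 ∷ 1150524 ∷ 1160625 ∷ 136351715070527 ∷ 1170734 ∷ 127170735 ∷ 128180837 ∷ [])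
  ∷ (11716070603 ∷ 127241716070605 ∷ 1353427170707 ∷ 11716070613 ∷ 127241716070615 ∷ 1353427170717 ∷ 11716070623 ∷ 1271716070625 ∷ 13635170727 ∷ 11817080733 ∷ 12827170735 ∷ [])
  ∷ (1171603 ∷ 1171604 ∷ 12724171605 ∷ 12506 ∷ 13534271707 ∷ 13708 ∷ 1070612 ∷ 1070613 ∷ 12724070615 ∷ 12516 ∷ 13534270717 ∷ 1070622 ∷ 11716070623 ∷ 1171624 ∷ 117160625 ∷ 13635170727 ∷ 10732 ∷ 11817080733 ∷ 11734 ∷ 12827170735 ∷ [])
  ∷ (1131204 ∷ 122151305 ∷ 125231506 ∷ 13533322723171207 ∷ 13308 ∷ 10313 ∷ 1242305040315 ∷ 125240516 ∷ 13534332723070417 ∷ 10523 ∷ 1150524 ∷ 116150625 ∷ 136351715070527 ∷ 10733 ∷ 1170734 ∷ 127170735 ∷ 128180837 ∷ [])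
  ∷ (10704 ∷ 124160705 ∷ 12717160606 ∷ 135342724171607 ∷ 12708 ∷ 12724070615 ∷ 1271716070616 ∷ 135342724070617 ∷ 1070623 ∷ 11716070624 ∷ 13635271716070627 ∷ 1080733 ∷ 118170734 ∷ 1282718170735 ∷ [])
  ∷ (10703 ∷ 11604 ∷ 12305 ∷ 12724170306 ∷ 135342724171607 ∷ 1070613 ∷ 127240715 ∷ 12724070416 ∷ 135342524070617 ∷ 10723 ∷ 11716070624 ∷ 1271725 ∷ 13635271716070627 ∷ 10733 ∷ 11817080734 ∷ 128271817080735 ∷ [])
  ∷ (1131204 ∷ 1231513050305 ∷ 125231506 ∷ 13533272523171507050307 ∷ 13708 ∷ 10313 ∷ 12313050415 ∷ 125230516 ∷ 13533272523171513070517 ∷ 10523 ∷ 1150524 ∷ 10525 ∷ 1351715070527 ∷ 10733 ∷ 1170734 ∷ 127170735 ∷ [])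
  ∷ (1272423171506 ∷ 13635342827242318171615080706050407 ∷ 13308 ∷ 12723070516 ∷ 13635343328272418171607060517 ∷ 115070524 ∷ 13527171608070627 ∷ 1170734 ∷ 127170735 ∷ [])
  ∷ (10203 ∷ 1131204 ∷ 123221513050305 ∷ 1252306 ∷ 13533272523171507050307 ∷ 13708 ∷ 10313 ∷ 11314 ∷ 12313050415 ∷ 1252316 ∷ 13533272523171513070517 ∷ 10523 ∷ 11524 ∷ 1150525 ∷ 12526 ∷ 1351715070527 ∷ 10733 ∷ 11734 ∷ 127170735 ∷ [])
  ∷ (10503 ∷ 1171604 ∷ 12724171605 ∷ 12717150506 ∷ 135342723171507 ∷ 11708 ∷ 1070613 ∷ 124180615 ∷ 12715070516 ∷ 135342724070517 ∷ 1060523 ∷ 11716070624 ∷ 1170725 ∷ 136351716070627 ∷ 1080733 ∷ 118170734 ∷ 12827170735 ∷ [])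
  ∷ (127252317151307050306 ∷ 1353327252317151307050307 ∷ 13308 ∷ 127241407050416 ∷ 13534272524171407050417 ∷ 1171615070624 ∷ 1272525 ∷ 13517161507060527 ∷ 1170734 ∷ 127170735 ∷ [])
  ∷ (1171303 ∷ 1171504 ∷ 1272423161505 ∷ 12506 ∷ 1363534332827181707 ∷ 13708 ∷ 1050412 ∷ 1070413 ∷ 1272524060515 ∷ 12516 ∷ 13635342827080717 ∷ 1060522 ∷ 11716150523 ∷ 11524 ∷ 1160625 ∷ 13518170727 ∷ 10732 ∷ 118170733 ∷ 11734 ∷ 12717080735 ∷ [])
  ∷ (11715070503 ∷ 125231513070305 ∷ 13533272523171513050307 ∷ 11513070513 ∷ 12725231307050315 ∷ 1353325231715070317 ∷ 11715070523 ∷ 12725170525 ∷ 1352517150727 ∷ 1170733 ∷ 127170735 ∷ 10737 ∷ [])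
  ∷ (1130304 ∷ 12313050305 ∷ 125150506 ∷ 1353327252317151307050307 ∷ 13708 ∷ 10312 ∷ 12313050315 ∷ 125150516 ∷ 1353327252317151307050317 ∷ 10522 ∷ 1150523 ∷ 1150524 ∷ 135251715070527 ∷ 1170733 ∷ 1170734 ∷ 127170735 ∷ [])
  ∷ (1070503 ∷ 1171604 ∷ 1272417160705 ∷ 1272306 ∷ 13534272317070507 ∷ 1070613 ∷ 1171614 ∷ 127241817070615 ∷ 1272416 ∷ 1353427070517 ∷ 1070623 ∷ 1171624 ∷ 11716070525 ∷ 12726 ∷ 13635251716070627 ∷ 1080733 ∷ 1181734 ∷ 12827170735 ∷ [])
  ∷ (1070603 ∷ 1171604 ∷ 1272417160705 ∷ 1272406 ∷ 1353427241716070607 ∷ 1070613 ∷ 1171614 ∷ 1272417070615 ∷ 1272416 ∷ 135342724070617 ∷ 1070623 ∷ 1171624 ∷ 12725160725 ∷ 12726 ∷ 136351716070627 ∷ 10733 ∷ 1181734 ∷ 128271817080735 ∷ [])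
  ∷ (11716070603 ∷ 11604 ∷ 1272417070505 ∷ 12706 ∷ 13534272417160707 ∷ 11716070613 ∷ 12724150715 ∷ 13534272417070617 ∷ 11716070623 ∷ 1171624 ∷ 1272517070525 ∷ 136351716070627 ∷ 1170733 ∷ 1181734 ∷ 128271817080735 ∷ [])
  ∷ (1050303 ∷ 117151304 ∷ 127231715070505 ∷ 1252306 ∷ 1353327251513070307 ∷ 1070413 ∷ 1171414 ∷ 12725241714070515 ∷ 1252416 ∷ 13534252407050417 ∷ 1070623 ∷ 1171524 ∷ 12716150525 ∷ 12526 ∷ 13525171607060527 ∷ 10733 ∷ 11734 ∷ 127170735 ∷ [])
  ∷ (10704 ∷ 12724230705 ∷ 12717150506 ∷ 136353428272418171615080706050407 ∷ 12708 ∷ 1272316070515 ∷ 12715070516 ∷ 1363534332827241817070617 ∷ 1150723 ∷ 115070524 ∷ 12725 ∷ 135171608070627 ∷ 1170733 ∷ 1170734 ∷ 127170735 ∷ [])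
  ∷ (11512070503 ∷ 127242322171615070605 ∷ 135343332282718170707 ∷ 11715050413 ∷ 1272423171607060515 ∷ 1363534282717080717 ∷ 11715070523 ∷ 1271716070625 ∷ 1363518170727 ∷ 1170733 ∷ 127170735 ∷ 128180837 ∷ [])
  ∷ (1070503 ∷ 1151204 ∷ 127252215131207050305 ∷ 1252306 ∷ 13533322322151305030207 ∷ 1070413 ∷ 11714 ∷ 1272413070515 ∷ 1272516 ∷ 1353425241514050417 ∷ 1070623 ∷ 117161524 ∷ 127251715070625 ∷ 12526 ∷ 1352516150527 ∷ 10733 ∷ 11734 ∷ 127170735 ∷ 13737 ∷ [])
  ∷ (107050302 ∷ 1171513070503 ∷ 12725231715070505 ∷ 1353327170707 ∷ 1050412 ∷ 11714050413 ∷ 12725241715070515 ∷ 1353427170717 ∷ 107060522 ∷ 1171615070623 ∷ 11724 ∷ 1272517160725 ∷ 13635170727 ∷ 10732 ∷ 1170733 ∷ 11734 ∷ 127170735 ∷ 128180837 ∷ [])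
  ∷ (1050302 ∷ 11513070503 ∷ 11504 ∷ 12725232213070205 ∷ 12306 ∷ 135333225221512050307 ∷ 107050412 ∷ 11715050313 ∷ 12724140715 ∷ 13534252313050417 ∷ 1060522 ∷ 11716070623 ∷ 11524 ∷ 12725170525 ∷ 13525150527 ∷ 10732 ∷ 1170733 ∷ 11734 ∷ 127170735 ∷ 137170737 ∷ [])
  ∷ (11513050403 ∷ 1171504 ∷ 127242316150705 ∷ 12506 ∷ 136353433282718170707 ∷ 1050412 ∷ 11715070413 ∷ 127252417060515 ∷ 12516 ∷ 1363534282717080717 ∷ 1060522 ∷ 11716150523 ∷ 11524 ∷ 11716070625 ∷ 13518170727 ∷ 10732 ∷ 118170733 ∷ 11734 ∷ 12717080735 ∷ [])
  ∷ (10704 ∷ 1272522151307050205 ∷ 1232212070306 ∷ 1353332232215131205030207 ∷ 12308 ∷ 11713 ∷ 1271407050315 ∷ 1242313040316 ∷ 13534332524231513040317 ∷ 117150723 ∷ 1150524 ∷ 1272525 ∷ 135251615060527 ∷ 10733 ∷ 1170734 ∷ 127170735 ∷ 13737 ∷ [])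
  ∷ (117070503 ∷ 117151304 ∷ 127231513070305 ∷ 12506 ∷ 1353325231707050307 ∷ 10412 ∷ 11715070513 ∷ 11414 ∷ 1272417140715 ∷ 12516 ∷ 1353427251715070517 ∷ 107060522 ∷ 11716070623 ∷ 11524 ∷ 12717150525 ∷ 1363525170727 ∷ 1080732 ∷ 118170733 ∷ 127170735 ∷ 1372837 ∷ [])
  ∷ (1070502 ∷ 11715070503 ∷ 11304 ∷ 127252313070305 ∷ 12506 ∷ 1353325231513050307 ∷ 1070512 ∷ 117150513 ∷ 1272414050415 ∷ 12416 ∷ 13534252414050417 ∷ 10522 ∷ 11716070623 ∷ 11624 ∷ 1272517150725 ∷ 136352515060527 ∷ 10732 ∷ 1170733 ∷ 1181734 ∷ 128271817080735 ∷ 13737 ∷ [])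
  ∷ (1070502 ∷ 11715070503 ∷ 11304 ∷ 127252313070305 ∷ 12506 ∷ 1353325231513050307 ∷ 1070512 ∷ 117150513 ∷ 1272414050415 ∷ 12416 ∷ 13534252414050417 ∷ 1070622 ∷ 11716070623 ∷ 11624 ∷ 1272517150725 ∷ 136352515060527 ∷ 10732 ∷ 1170733 ∷ 1181734 ∷ 128271817080735 ∷ 13737 ∷ [])
  ∷ [])
openRights = map decodeType (
    (13020100000 ∷ 13020100010 ∷ 13020100020 ∷ 130201030 ∷ [])
  ∷ (10101 ∷ 11103 ∷ 12105 ∷ 13107 ∷ 10311 ∷ 11313 ∷ 12315 ∷ 13317 ∷ 10521 ∷ 11523 ∷ 12525 ∷ 13527 ∷ 10731 ∷ 11733 ∷ 12735 ∷ 13737 ∷ [])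
  ∷ (1070501 ∷ 1151303 ∷ 1272305 ∷ 1353307 ∷ 1070511 ∷ 1171513 ∷ 1272415 ∷ 1353417 ∷ 10521 ∷ 11523 ∷ 1272625 ∷ 13527 ∷ 10731 ∷ 11733 ∷ 12735 ∷ 13737 ∷ [])
  ∷ (1070601 ∷ 1171603 ∷ 1272405 ∷ 1353407 ∷ 1070611 ∷ 1171613 ∷ 1272415 ∷ 1353417 ∷ 1070621 ∷ 1171623 ∷ 12525 ∷ 13527 ∷ 10731 ∷ 11733 ∷ 12735 ∷ 13737 ∷ [])
  ∷ (13533252317150500 ∷ 13533272515130310 ∷ 13531272517110320 ∷ 1372721171530 ∷ [])
  ∷ (1353427241716070600 ∷ 13534272417160610 ∷ 1353427241716070620 ∷ 1353427160730 ∷ [])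
  ∷ (1353327231713050300 ∷ 1353327231713070510 ∷ 13533272317070320 ∷ 1353327070530 ∷ [])
  ∷ (1201006 ∷ 130201007 ∷ 11008 ∷ 13020100016 ∷ 13020100017 ∷ 12018 ∷ 130201024 ∷ 130200027 ∷ 12028 ∷ 130200034 ∷ 130201035 ∷ 130201036 ∷ [])
  ∷ (120100003 ∷ 13020100005 ∷ 13020100007 ∷ 120100013 ∷ 120100015 ∷ 13020100017 ∷ 130201023 ∷ 1200025 ∷ 13020100027 ∷ 1100033 ∷ 1100035 ∷ [])
  ∷ (12523151306 ∷ 135332723171307 ∷ 13308 ∷ 12523050316 ∷ 135332523050317 ∷ 13318 ∷ 1150524 ∷ 13517070527 ∷ 13528 ∷ 1170734 ∷ 127170735 ∷ 12736 ∷ [])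
  ∷ (121110106 ∷ 13121110107 ∷ 12108 ∷ 123130316 ∷ 13323130317 ∷ 1130318 ∷ 1150524 ∷ 12525 ∷ 13525150527 ∷ 125150528 ∷ 1170734 ∷ 127170735 ∷ 1170736 ∷ 13737 ∷ [])
  ∷ (12723151306 ∷ 135332725171307 ∷ 13308 ∷ 12724050416 ∷ 135342524050417 ∷ 1341518 ∷ 1150524 ∷ 13517070527 ∷ 13528 ∷ 1170734 ∷ 127170735 ∷ 12736 ∷ [])
  ∷ (12724171506 ∷ 135342724171507 ∷ 13308 ∷ 12724070516 ∷ 135342724070617 ∷ 1353418 ∷ 1150524 ∷ 1352715070627 ∷ 13528 ∷ 1170734 ∷ 127170735 ∷ 12736 ∷ [])
  ∷ (12723171306 ∷ 135332725151307 ∷ 13508 ∷ 12724070416 ∷ 135342724070517 ∷ 1353418 ∷ 11715070524 ∷ 13517070627 ∷ 13528 ∷ 1170734 ∷ 127170735 ∷ 12736 ∷ [])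
  ∷ (10103 ∷ 11104 ∷ 121110105 ∷ 12106 ∷ 13121110107 ∷ 13108 ∷ 10313 ∷ 11314 ∷ 123130315 ∷ 12316 ∷ 13323130317 ∷ 13318 ∷ 10523 ∷ 11524 ∷ 125150525 ∷ 13525150527 ∷ 13528 ∷ 10733 ∷ 11734 ∷ 1170735 ∷ 12736 ∷ 13737 ∷ [])
  ∷ (12724171606 ∷ 135342724171607 ∷ 13508 ∷ 12724070616 ∷ 135342724070617 ∷ 1353418 ∷ 11716070624 ∷ 13517070627 ∷ 13528 ∷ 1170734 ∷ 127170735 ∷ 12736 ∷ [])
  ∷ (11203 ∷ 11304 ∷ 123221505 ∷ 12506 ∷ 13532271707 ∷ 13708 ∷ 10312 ∷ 10413 ∷ 1230515 ∷ 12516 ∷ 13533270717 ∷ 13718 ∷ 10522 ∷ 1150523 ∷ 11524 ∷ 1160625 ∷ 135170727 ∷ 13728 ∷ 10732 ∷ 1170733 ∷ 11734 ∷ 127170735 ∷ 12736 ∷ [])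
  ∷ (12724171306 ∷ 135342724171507 ∷ 1353408 ∷ 12724070416 ∷ 135342524070617 ∷ 1353418 ∷ 115070624 ∷ 1352715070627 ∷ 13528 ∷ 1170734 ∷ 127170735 ∷ 12736 ∷ [])
  ∷ (12523151306 ∷ 135332523171307 ∷ 1231308 ∷ 12723070516 ∷ 1353327070517 ∷ 10518 ∷ 127150524 ∷ 13517150727 ∷ 1150528 ∷ 115070534 ∷ 123150735 ∷ 1271336 ∷ [])
  ∷ (1272417160706 ∷ 135342717160607 ∷ 1270708 ∷ 12724070616 ∷ 135342716070617 ∷ 10718 ∷ 11716070624 ∷ 13517160727 ∷ 1170728 ∷ 117070634 ∷ 117160735 ∷ 1160736 ∷ [])
  ∷ (1272515130706 ∷ 137332717050307 ∷ 1110108 ∷ 1272517070316 ∷ 1373125231311070317 ∷ 10518 ∷ 13121030124 ∷ 135230727 ∷ 10328 ∷ 1110334 ∷ 13123210335 ∷ 13336 ∷ [])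
  ∷ (1272517130506 ∷ 13531252117110507 ∷ 11108 ∷ 1272517050116 ∷ 137232113070517 ∷ 11318 ∷ 12713070324 ∷ 13725171527 ∷ 12128 ∷ 13331271134 ∷ 137210335 ∷ 13736 ∷ [])
  ∷ (12521151106 ∷ 137352521171507 ∷ 12508 ∷ 12521050116 ∷ 137312725050317 ∷ 1030118 ∷ 113110124 ∷ 1333117150127 ∷ 113030128 ∷ 1110334 ∷ 12521150335 ∷ 1130136 ∷ [])
  ∷ (131211101 ∷ 133231303 ∷ 135251505 ∷ 137271707 ∷ 1210111 ∷ 133230313 ∷ 135250515 ∷ 137270717 ∷ 131110121 ∷ 133130323 ∷ 135150525 ∷ 137170727 ∷ 1210131 ∷ 123130333 ∷ 1250535 ∷ 11737 ∷ [])
  ∷ (127251514070606 ∷ 13534252417150407 ∷ 1270708 ∷ 12725070316 ∷ 135332713050317 ∷ 10718 ∷ 13317150724 ∷ 13517130727 ∷ 1170728 ∷ 1170334 ∷ 117150735 ∷ 1150736 ∷ [])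
  ∷ (12321151306 ∷ 1372521131107 ∷ 1331308 ∷ 123211511030116 ∷ 1372321130717 ∷ 1110118 ∷ 13727171524 ∷ 137250727 ∷ 1210128 ∷ 13331130134 ∷ 13531170535 ∷ 1372736 ∷ [])
  ∷ (113070503 ∷ 11504 ∷ 1251715070505 ∷ 1353327170707 ∷ 11715050413 ∷ 1272417070515 ∷ 1353427170717 ∷ 11715070523 ∷ 11716070625 ∷ 135170727 ∷ 1170733 ∷ 1170735 ∷ [])
  ∷ (1151303 ∷ 1171504 ∷ 127241505 ∷ 12506 ∷ 13534271707 ∷ 13708 ∷ 10712 ∷ 10413 ∷ 127250515 ∷ 12516 ∷ 13534270717 ∷ 13718 ∷ 10522 ∷ 115070623 ∷ 11524 ∷ 1160625 ∷ 135170727 ∷ 13728 ∷ 10732 ∷ 1170733 ∷ 11734 ∷ 127170735 ∷ 12736 ∷ [])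
  ∷ (11715070503 ∷ 127231715070305 ∷ 1353327170707 ∷ 11715070513 ∷ 1272317070515 ∷ 1353327170717 ∷ 11715070523 ∷ 11715070525 ∷ 135170727 ∷ 1170733 ∷ 1170735 ∷ [])
  ∷ (11715070503 ∷ 127241715070505 ∷ 1353327170707 ∷ 11715070513 ∷ 1272417070615 ∷ 1353327170717 ∷ 11715070523 ∷ 11716070625 ∷ 135170727 ∷ 1170733 ∷ 1170735 ∷ [])
  ∷ (11716070603 ∷ 127241716070605 ∷ 1353427170707 ∷ 11716070613 ∷ 1272417070615 ∷ 1353427170717 ∷ 11716070623 ∷ 11716070625 ∷ 135170727 ∷ 1170733 ∷ 1170735 ∷ [])
  ∷ (11716070503 ∷ 1251716070605 ∷ 135342717050407 ∷ 11716070613 ∷ 1272515070615 ∷ 1353327130717 ∷ 12715070423 ∷ 113070325 ∷ 135170727 ∷ 125150733 ∷ 1170735 ∷ [])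
  ∷ (1332523151306 ∷ 1353327171507 ∷ 1370708 ∷ 13531252115050116 ∷ 137352717070117 ∷ 1372718 ∷ 113030124 ∷ 13721130727 ∷ 1371728 ∷ 113030134 ∷ 113050335 ∷ 1251536 ∷ [])
  ∷ (1232113110106 ∷ 13531252113110107 ∷ 11108 ∷ 1232113030116 ∷ 13331252117150717 ∷ 1130518 ∷ 13121131124 ∷ 1333125211727 ∷ 10328 ∷ 1110334 ∷ 13125110535 ∷ 13336 ∷ [])
  ∷ (10502 ∷ 1130203 ∷ 11204 ∷ 12712070305 ∷ 12206 ∷ 137332312050307 ∷ 10712 ∷ 1170313 ∷ 11514 ∷ 12724130315 ∷ 12316 ∷ 13734231317 ∷ 10522 ∷ 10523 ∷ 11524 ∷ 125170525 ∷ 13525150527 ∷ 10732 ∷ 10733 ∷ 11734 ∷ 1170735 ∷ 13737 ∷ [])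
  ∷ (11715070503 ∷ 1251513070305 ∷ 137332717050307 ∷ 11513070513 ∷ 1272317070315 ∷ 1353327170717 ∷ 11715070523 ∷ 11715070525 ∷ 13525150727 ∷ 1170733 ∷ 1170735 ∷ [])
  ∷ (127221512050406 ∷ 1333227231716050407 ∷ 10508 ∷ 1272317070516 ∷ 13534271716070617 ∷ 1231518 ∷ 112070424 ∷ 1352712070527 ∷ 11528 ∷ 115050434 ∷ 123050435 ∷ 11536 ∷ [])
  ∷ (127231716050406 ∷ 13533272317150707 ∷ 1270708 ∷ 12723070616 ∷ 135332713070617 ∷ 1170718 ∷ 13517070324 ∷ 13525130527 ∷ 1170728 ∷ 113050434 ∷ 122130335 ∷ 1150536 ∷ [])
  ∷ (11304 ∷ 122151205 ∷ 125221506 ∷ 1333227171307 ∷ 1351708 ∷ 123050415 ∷ 125230516 ∷ 135342723070417 ∷ 133270718 ∷ 10523 ∷ 1150524 ∷ 11525 ∷ 1351715070527 ∷ 1170728 ∷ 10733 ∷ 1170734 ∷ 1170735 ∷ 1170736 ∷ [])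
  ∷ (1272417150706 ∷ 1353427241715070607 ∷ 1170708 ∷ 1272317070516 ∷ 135332715070517 ∷ 1271718 ∷ 13417070524 ∷ 1352715070427 ∷ 1170728 ∷ 123170734 ∷ 123070635 ∷ 1150536 ∷ [])
  ∷ (1171603 ∷ 1171604 ∷ 12724171605 ∷ 12506 ∷ 13534271707 ∷ 13708 ∷ 10712 ∷ 1070613 ∷ 12724070615 ∷ 12516 ∷ 13534270717 ∷ 13718 ∷ 1070622 ∷ 117070623 ∷ 1171624 ∷ 1160625 ∷ 135170727 ∷ 13728 ∷ 10732 ∷ 1170733 ∷ 11734 ∷ 127170735 ∷ 12736 ∷ [])
  ∷ (1070503 ∷ 1171504 ∷ 12715130205 ∷ 1272306 ∷ 13533252312050307 ∷ 13508 ∷ 1070513 ∷ 11714 ∷ 125130315 ∷ 12316 ∷ 1332523130317 ∷ 1353418 ∷ 10523 ∷ 11524 ∷ 125170525 ∷ 13525150527 ∷ 13528 ∷ 10733 ∷ 11734 ∷ 1170735 ∷ 12736 ∷ 13737 ∷ [])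
  ∷ (135332723070503 ∷ 135332717150705 ∷ 12523130507 ∷ 135332523150713 ∷ 1332317070515 ∷ 1231513050317 ∷ 13533251723 ∷ 13523130525 ∷ 125151327 ∷ 123130533 ∷ 1130535 ∷ [])
  ∷ (1372725170703 ∷ 13727151105 ∷ 1333125231107 ∷ 1352521131113 ∷ 13531271315 ∷ 135332321131117 ∷ 137270723 ∷ 1333125230525 ∷ 13523130527 ∷ 135251133 ∷ 13331230135 ∷ [])
  ∷ (1241705 ∷ 13527150706 ∷ 1353427241715070407 ∷ 1270508 ∷ 12415 ∷ 12715070616 ∷ 135342717070617 ∷ 1150518 ∷ 135170724 ∷ 10525 ∷ 1352716070427 ∷ 1150528 ∷ 117160534 ∷ 127150435 ∷ 1150736 ∷ [])
  ∷ (1272417160706 ∷ 1353427241716070607 ∷ 1170708 ∷ 1272417070616 ∷ 135342716070617 ∷ 1271718 ∷ 11716070624 ∷ 1352416070627 ∷ 1170728 ∷ 124170734 ∷ 12724070635 ∷ 1160736 ∷ [])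
  ∷ (133272317150506 ∷ 135332717150507 ∷ 1170708 ∷ 13533272317070516 ∷ 135332717070517 ∷ 1270718 ∷ 11715070524 ∷ 13525130527 ∷ 1170728 ∷ 12315050334 ∷ 113050335 ∷ 1150536 ∷ [])
  ∷ (1332723050403 ∷ 13504 ∷ 135332717160705 ∷ 125241715050307 ∷ 1353327231713 ∷ 1332713070515 ∷ 12313070617 ∷ 13327171323 ∷ 13524 ∷ 135270725 ∷ 12417070327 ∷ 1130533 ∷ 1130535 ∷ [])
  ∷ (1353325231513050306 ∷ 13725231713070307 ∷ 10508 ∷ 131252111050116 ∷ 13731252111070117 ∷ 1110118 ∷ 13313110324 ∷ 13733210727 ∷ 10128 ∷ 131130134 ∷ 13321130335 ∷ 13336 ∷ [])
  ∷ (131211103 ∷ 13304 ∷ 131211305 ∷ 1251506 ∷ 133312521171307 ∷ 131210113 ∷ 10314 ∷ 135210115 ∷ 1250516 ∷ 1373527070517 ∷ 131110123 ∷ 10324 ∷ 13111050325 ∷ 1333113070527 ∷ 1211133 ∷ 1130334 ∷ 121130335 ∷ [])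
  ∷ (13101 ∷ 1352523030103 ∷ 135332115130705 ∷ 125211513050307 ∷ 1353323211713 ∷ 135232111070315 ∷ 12113030117 ∷ 1372321171123 ∷ 13523050325 ∷ 123130127 ∷ 1130533 ∷ 1130135 ∷ [])
  ∷ (10704 ∷ 124150705 ∷ 127170706 ∷ 13534272417150707 ∷ 1270708 ∷ 123070615 ∷ 127150716 ∷ 135332717070617 ∷ 1170718 ∷ 1150523 ∷ 1170524 ∷ 1352515070527 ∷ 1170728 ∷ 11733 ∷ 1170734 ∷ 127170735 ∷ 1170736 ∷ [])
  ∷ (1070503 ∷ 11204 ∷ 1221713070305 ∷ 12206 ∷ 132221713050307 ∷ 13208 ∷ 1050413 ∷ 1151414 ∷ 12517050415 ∷ 12316 ∷ 133272517070417 ∷ 13318 ∷ 10523 ∷ 11524 ∷ 12717070625 ∷ 13525150527 ∷ 13728 ∷ 10733 ∷ 11734 ∷ 1170735 ∷ 12736 ∷ 13737 ∷ [])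
  ∷ (1070303 ∷ 1171304 ∷ 1271715050305 ∷ 1272306 ∷ 13533271513070507 ∷ 1070413 ∷ 11514 ∷ 125050415 ∷ 1272516 ∷ 13534272414050417 ∷ 10523 ∷ 1171524 ∷ 12715070625 ∷ 1352515070527 ∷ 10733 ∷ 11734 ∷ 1170735 ∷ [])
  ∷ (10203 ∷ 1131204 ∷ 1221512030205 ∷ 1232206 ∷ 13532272217150207 ∷ 13708 ∷ 10313 ∷ 11314 ∷ 12315050315 ∷ 1252316 ∷ 13534252417070317 ∷ 13718 ∷ 10523 ∷ 11524 ∷ 125150525 ∷ 1352517150527 ∷ 13728 ∷ 10733 ∷ 11734 ∷ 1170735 ∷ 12736 ∷ [])
  ∷ (12304 ∷ 127150305 ∷ 13533170706 ∷ 13534272317070607 ∷ 10508 ∷ 1332723130515 ∷ 135170716 ∷ 13533252313070517 ∷ 1231518 ∷ 13517070324 ∷ 1352313070427 ∷ 11328 ∷ 115050334 ∷ 1230535 ∷ 1150436 ∷ [])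
  ∷ (13533271203 ∷ 1353427231512070505 ∷ 127221712050407 ∷ 13533271713 ∷ 1352317150715 ∷ 10616 ∷ 1272317160717 ∷ 135271723 ∷ 13424 ∷ 13533271325 ∷ 112050427 ∷ 125151333 ∷ 125221535 ∷ [])
  ∷ (13301 ∷ 1352723070603 ∷ 135332717150705 ∷ 1231716070407 ∷ 1332311 ∷ 135271713 ∷ 133271715070515 ∷ 1221715070517 ∷ 1353327150723 ∷ 135270725 ∷ 124170527 ∷ 123170733 ∷ 135170735 ∷ [])
  ∷ (11304 ∷ 12315130305 ∷ 1251506 ∷ 1353327171507 ∷ 1371708 ∷ 10312 ∷ 123050315 ∷ 1250516 ∷ 135332523070517 ∷ 137270718 ∷ 10522 ∷ 1150523 ∷ 1150524 ∷ 1351715070527 ∷ 137170728 ∷ 10732 ∷ 10733 ∷ 1170734 ∷ 127170735 ∷ 1271736 ∷ [])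
  ∷ (13723070503 ∷ 1372117130305 ∷ 1353325211513030107 ∷ 12725171513 ∷ 135232117070115 ∷ 1353325231511030117 ∷ 13723171323 ∷ 137270725 ∷ 13123130127 ∷ 115130333 ∷ 1130535 ∷ [])
  ∷ (11503 ∷ 11704 ∷ 1271305 ∷ 12725171606 ∷ 1373427171407 ∷ 12708 ∷ 12513 ∷ 125050415 ∷ 12725070516 ∷ 1353427070617 ∷ 1270718 ∷ 11523 ∷ 1150524 ∷ 11625 ∷ 1351713050327 ∷ 1370728 ∷ 10533 ∷ 117070434 ∷ 12517130735 ∷ 127171636 ∷ [])
  ∷ (135271303 ∷ 10704 ∷ 1352523170305 ∷ 135332717150307 ∷ 135271713 ∷ 13114 ∷ 135312521170715 ∷ 10116 ∷ 137272515070117 ∷ 137271323 ∷ 10124 ∷ 13331271725 ∷ 13331210727 ∷ 1351533 ∷ 10334 ∷ 13331250135 ∷ [])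
  ∷ (135312111050103 ∷ 1332715130705 ∷ 13331252113030107 ∷ 12315050313 ∷ 131232115050115 ∷ 13531232111030117 ∷ 13327130523 ∷ 12521110525 ∷ 13523110327 ∷ 1230133 ∷ 1110335 ∷ [])
  ∷ (13725171503 ∷ 12704 ∷ 13725151105 ∷ 12106 ∷ 1353323211107 ∷ 1332725171513 ∷ 13331251315 ∷ 12116 ∷ 1332523131117 ∷ 10722 ∷ 13125211523 ∷ 1271524 ∷ 1372723151325 ∷ 13321151127 ∷ 1231133 ∷ 11134 ∷ 1231135 ∷ [])
  ∷ (13534252403 ∷ 13727170505 ∷ 1140406 ∷ 1353425241716050407 ∷ 137271713 ∷ 1353323170715 ∷ 1130316 ∷ 1353323160717 ∷ 13534271723 ∷ 10524 ∷ 137270725 ∷ 13524170427 ∷ 1352533 ∷ 10334 ∷ 135231735 ∷ [])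
  ∷ (1353427171603 ∷ 13534272417070605 ∷ 1272417160707 ∷ 13534271713 ∷ 13527241716070615 ∷ 1272417160717 ∷ 1353427170623 ∷ 13534271725 ∷ 11716070627 ∷ 127241733 ∷ 127241735 ∷ [])
  ∷ (10604 ∷ 1241605 ∷ 12717070606 ∷ 1353427241716070607 ∷ 1271708 ∷ 1240715 ∷ 12716070616 ∷ 13534271716070617 ∷ 1170718 ∷ 11623 ∷ 11716070624 ∷ 1352716070627 ∷ 1170728 ∷ 11733 ∷ 1170734 ∷ 127170735 ∷ 1170736 ∷ [])
  ∷ (13527140403 ∷ 13404 ∷ 135342726170705 ∷ 127251514070607 ∷ 13533271713 ∷ 135272613050315 ∷ 127251715050317 ∷ 1353315130323 ∷ 12724 ∷ 13533271725 ∷ 117130327 ∷ 125151333 ∷ 127251535 ∷ [])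
  ∷ (10702 ∷ 1070503 ∷ 1171304 ∷ 1271715070505 ∷ 1252306 ∷ 13533231513050307 ∷ 10512 ∷ 115070513 ∷ 11714 ∷ 1272417050415 ∷ 1272416 ∷ 1353425241417 ∷ 10522 ∷ 1070623 ∷ 11524 ∷ 127170525 ∷ 13525150527 ∷ 10732 ∷ 10733 ∷ 11734 ∷ 1170735 ∷ 13737 ∷ [])
  ∷ (1070603 ∷ 1171604 ∷ 1271716070605 ∷ 1272406 ∷ 13534271716070607 ∷ 1070613 ∷ 1171614 ∷ 12724070615 ∷ 1272416 ∷ 13534272417070617 ∷ 1070623 ∷ 1171624 ∷ 12517070625 ∷ 135251716070627 ∷ 10733 ∷ 11734 ∷ 1170735 ∷ [])
  ∷ (12404 ∷ 134251605 ∷ 13517070606 ∷ 137272417070607 ∷ 1170708 ∷ 134251615 ∷ 13517070616 ∷ 13725241716070617 ∷ 1271718 ∷ 13517070624 ∷ 137271716070627 ∷ 1170728 ∷ 124170734 ∷ 12725070635 ∷ 1160736 ∷ [])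
  ∷ (10704 ∷ 12417160705 ∷ 127170706 ∷ 13534272417160707 ∷ 1270708 ∷ 124070615 ∷ 127170716 ∷ 135342717070617 ∷ 1170718 ∷ 116070623 ∷ 117070624 ∷ 135271716070627 ∷ 1170728 ∷ 11733 ∷ 1170734 ∷ 127170735 ∷ 1170736 ∷ [])
  ∷ (11504 ∷ 1271305 ∷ 1252315050306 ∷ 13533252317150307 ∷ 1231308 ∷ 1231315 ∷ 12523050316 ∷ 135332713050317 ∷ 1150318 ∷ 1130723 ∷ 135170524 ∷ 1352713070527 ∷ 1150328 ∷ 10533 ∷ 115050334 ∷ 12523150335 ∷ 1150536 ∷ [])
  ∷ (1230304 ∷ 133231305 ∷ 1351513050306 ∷ 137272517050307 ∷ 1130708 ∷ 1312115 ∷ 1351511050116 ∷ 1353127251711050117 ∷ 1271518 ∷ 11123 ∷ 1333111030124 ∷ 133312311070127 ∷ 11328 ∷ 1130134 ∷ 1230135 ∷ 11336 ∷ [])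
  ∷ (1333123211103 ∷ 1333123211513030105 ∷ 125211711030107 ∷ 1333123211313 ∷ 135252111030115 ∷ 125231711070317 ∷ 1333121131123 ∷ 1333123110325 ∷ 1110327 ∷ 121131133 ∷ 1231135 ∷ [])
  ∷ (1230704 ∷ 133170705 ∷ 12715070506 ∷ 13533272317160707 ∷ 1270708 ∷ 123070615 ∷ 13527170716 ∷ 135342717070517 ∷ 1170718 ∷ 1350523 ∷ 117150524 ∷ 1352715070427 ∷ 1170728 ∷ 12333 ∷ 1170734 ∷ 127170735 ∷ 127170536 ∷ [])
  ∷ (13527171601 ∷ 135342724070603 ∷ 13517070605 ∷ 127170707 ∷ 13534241711 ∷ 13527070613 ∷ 1351716070615 ∷ 127170717 ∷ 13534271721 ∷ 13527070623 ∷ 1351716070625 ∷ 1170727 ∷ 1241731 ∷ 1270733 ∷ 1170735 ∷ [])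
  ∷ (1231701 ∷ 1373121150703 ∷ 137312117030105 ∷ 1252115110107 ∷ 1371711 ∷ 12521150713 ∷ 133231311030115 ∷ 12313110117 ∷ 1370521 ∷ 13731251723 ∷ 1333123110325 ∷ 123110327 ∷ 12331 ∷ 125210133 ∷ 1110335 ∷ [])
  ∷ (1270704 ∷ 13425070605 ∷ 13517150706 ∷ 137272517070607 ∷ 10708 ∷ 10512 ∷ 133250715 ∷ 13517160716 ∷ 13727231716070317 ∷ 1271718 ∷ 10423 ∷ 13517050424 ∷ 1372313070327 ∷ 1170728 ∷ 10733 ∷ 124170734 ∷ 123070435 ∷ 1160736 ∷ [])
  ∷ (1353427241703 ∷ 135342717160705 ∷ 10606 ∷ 1272417160707 ∷ 13534271713 ∷ 135272417160715 ∷ 10616 ∷ 1272417160717 ∷ 13534271723 ∷ 10724 ∷ 1353427070625 ∷ 13417070627 ∷ 127241733 ∷ 12434 ∷ 12717160635 ∷ [])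
  ∷ (127150301 ∷ 1353323130703 ∷ 1352517150705 ∷ 127170707 ∷ 13533271311 ∷ 1352723130713 ∷ 1352517070515 ∷ 127170717 ∷ 1353323150721 ∷ 1352517050323 ∷ 13525171525 ∷ 1170727 ∷ 1130531 ∷ 1231533 ∷ 1150535 ∷ 11737 ∷ [])
  ∷ (135271701 ∷ 13534272416050403 ∷ 13517070605 ∷ 127170707 ∷ 13533271511 ∷ 135272317070613 ∷ 1351716070615 ∷ 127170717 ∷ 13533271521 ∷ 13527170523 ∷ 1351715070525 ∷ 1170727 ∷ 11731 ∷ 123050433 ∷ 1170735 ∷ [])
  ∷ (135231701 ∷ 1373327070503 ∷ 1351513070505 ∷ 1272517070507 ∷ 135251111 ∷ 1353127070113 ∷ 1351511070115 ∷ 121110717 ∷ 13733271321 ∷ 13127070123 ∷ 13713070325 ∷ 123170727 ∷ 1151131 ∷ 123050133 ∷ 1150135 ∷ [])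
  ∷ (1070502 ∷ 11715070603 ∷ 1171604 ∷ 1272415070505 ∷ 12706 ∷ 135332315050407 ∷ 1070612 ∷ 11716070513 ∷ 11514 ∷ 12317070515 ∷ 12716 ∷ 13534231317 ∷ 10522 ∷ 11716070623 ∷ 1171624 ∷ 125170525 ∷ 13525150527 ∷ 10732 ∷ 1170733 ∷ 11734 ∷ 1170735 ∷ 13737 ∷ [])
  ∷ (1070301 ∷ 13533251303 ∷ 135342215120705 ∷ 12315120507 ∷ 134170311 ∷ 13527251313 ∷ 1352524130715 ∷ 125231513050417 ∷ 1230521 ∷ 135332723150723 ∷ 13527231725 ∷ 12524151327 ∷ 10731 ∷ 1271733 ∷ 127171335 ∷ 12337 ∷ [])
  ∷ (12403 ∷ 1171604 ∷ 12524171605 ∷ 125171606 ∷ 135342524171607 ∷ 1371708 ∷ 1342413 ∷ 10714 ∷ 12725070615 ∷ 1250716 ∷ 1372524070617 ∷ 137270718 ∷ 135170723 ∷ 11716070624 ∷ 1341725 ∷ 1351716070627 ∷ 1170728 ∷ 12433 ∷ 1170734 ∷ 1170735 ∷ 1170736 ∷ [])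
  ∷ (137270603 ∷ 10704 ∷ 1353427241705 ∷ 1160706 ∷ 1353425241716070607 ∷ 11612 ∷ 135271713 ∷ 135342724170715 ∷ 1170616 ∷ 1353427251716070617 ∷ 13527070623 ∷ 1340724 ∷ 137270725 ∷ 13525170627 ∷ 1351733 ∷ 12534 ∷ 1352735 ∷ 11736 ∷ [])
  ∷ (13527171501 ∷ 135342724070503 ∷ 1351715070605 ∷ 127170707 ∷ 1353323171511 ∷ 13527070513 ∷ 1351716070615 ∷ 127170717 ∷ 13533271321 ∷ 13527070423 ∷ 1351715070525 ∷ 1170727 ∷ 123151331 ∷ 124050433 ∷ 1150535 ∷ 11737 ∷ [])
  ∷ (13527240703 ∷ 13404 ∷ 135342717150505 ∷ 10706 ∷ 127241715050407 ∷ 12412 ∷ 1353427171513 ∷ 135271715070615 ∷ 10716 ∷ 1231715070617 ∷ 13522 ∷ 13327050423 ∷ 135342724 ∷ 13534271725 ∷ 12716050427 ∷ 123170533 ∷ 10734 ∷ 11716070635 ∷ [])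
  ∷ (1352724171601 ∷ 1353427171603 ∷ 13525171605 ∷ 137271707 ∷ 12724070611 ∷ 135342724070613 ∷ 13525070615 ∷ 137270717 ∷ 135341716070621 ∷ 1353417070623 ∷ 135171625 ∷ 137170727 ∷ 1270731 ∷ 1271716070633 ∷ 1250735 ∷ [])
  ∷ (13527231301 ∷ 13534271403 ∷ 13525171605 ∷ 137271707 ∷ 12725070511 ∷ 1353427240513 ∷ 1352726070615 ∷ 137270717 ∷ 135331713050321 ∷ 135341514070423 ∷ 13517160725 ∷ 137170727 ∷ 125050331 ∷ 125170533 ∷ 1250535 ∷ 10737 ∷ [])
  ∷ (135272403 ∷ 13404 ∷ 135342717070605 ∷ 117160706 ∷ 1272417160707 ∷ 12412 ∷ 1353427171613 ∷ 135271716070615 ∷ 1160716 ∷ 1272417160717 ∷ 13522 ∷ 13527070623 ∷ 134270624 ∷ 13534271725 ∷ 12716070627 ∷ 11716070633 ∷ 10734 ∷ 124170735 ∷ [])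
  ∷ (133231303 ∷ 1330304 ∷ 135332515130305 ∷ 135150506 ∷ 13727251713050307 ∷ 1270708 ∷ 10112 ∷ 1312113 ∷ 135312511050115 ∷ 135150516 ∷ 13727251511070117 ∷ 1270718 ∷ 10122 ∷ 13113110123 ∷ 133130324 ∷ 13325 ∷ 137231311070327 ∷ 1170728 ∷ 12132 ∷ 121131133 ∷ 123130334 ∷ 125150335 ∷ 1251536 ∷ [])
  ∷ [])

openHints : List (List (ℕ × ℕ))
openHints = map decodeHints (
    1592563368221822163357731283473104235490777317731503159363325433177312210593633252210221033254930490759352210593628364226433035344810623473106235593633254932493049202210623561102110623520103310221028264335492092283310731022103310743049072510201074307430743074309228743009104810822148100910251048104810321092283210492032103210321022113210623018100404040406042307230723070604
  ∷ 1070308050805080508050805080507030805080508050805080508050703080508050703080507030703070307030805080508050703080508050805080508050703080507030805080507030703080508050703080508050703080507030703070308050805070307030703070307030703080508050703070308050805080508050703080507030703080507030703070307030703070307030703070307030703070307030703000000000000000000000805080508050000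
  ∷ 1860630067608651930067608300619063008300630196519760830191906301965191906301915061906190619063006300630191906301930193019301930191906301970063019301915066606300630061906301979061506301919061906150630193019300670161906660619064506651930061506190665196519651965197016651915061906760815061506150619061506190670164506850645061906190615061906301919060502050205027608890889090502
  ∷ 1592563368221822163357731283473104235490777317731503159363325433177312210593633252210221033254930490759352210593628364226433035344810623473106235593633254930493049202210623561102110623520103310221028264335492092283310731022103310743049072510201074307430743074309228743009104810822148100910251048104810321092283210492032103210321022103210623018100404040406042307230723070604
  ∷ 1641630148708811929144226291424062815261242264226760830191824282642262406281913242406240618242806261228192406301930193019282628192406282678062826301911245106280628062406282664060906281924061806090630192819290678162406240624064606422626121306240642264226422642267816422615064606870839061506090624062406240678163906600639062406240613062406281919060602050205028712901290120502
  ∷ 1592563368221822163357731283473104235490777317731503159363325433177312210593633252210221033254930490759352210593628364226433035344810623473106235593633254930493049202210623561102110623520103310221028264335492092283310731022103310743049072510201074307430743074309228743009104810822148100910251048104810321092283210492032103210321022103210623018100404040406042307230723070604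
  ∷ 1190630196519651930196508301919063008300630196519650830196606301965191906301915061506190619067906790630191906301930193006301930194506301919063019301915067906790679061906301930191506301919061906150630193019790691161906190619061506651979061506190665196519651965199116651915064506650815061506150645061506190691164506790645061906190615061906301919060502050205027608760876080502
  ∷ 1551428195733573328198433281955198715562228294229842928191824281942337213281911185106721818245613561328193613281928192806281928195513301955272819281909245613561356137218281928191106281918061806090628192919561347271806551318061206422656131206460642264226422642264727422646063606573339060906090636063906371347274613561346133713371336133713291919060602050205028722872287220502
  ∷ 1660630067608651930067608300619063008300630196519760830191906301965191906301915061506190619063006300630191906301930063006301930194506301966063019301915063006300630061906301930061506301919061906150630193019300665161906660619061506651930061506190665196519651965199116651915061906760815061506150619061506190691164506300645061906190615061906301919060502050205027608760876080502
  ∷ 1710630197619651930197608301919063008300630196519760830196606301965191906301915061506190619067906790630191906301930193006301930194506301966063019301915067906790679061906301930191506301919061906150630193019790691161906660619061506651979061506190665196519651965199116651915064506760815061506150645061506190691164506790645061906190615061906301919060502050205027608760876080502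
  ∷ 1182328244226422628264229282472234217421728264229422928261823282642297223282609230923722318244226421728267223282628242826282628262823282646232826282609244226422642267223282628240924282618241824092428262826422642261824722318240924422642260924182442264226422642264226422609241824422646240924092418240924462442264624422646244624462446244624282618240604060406048017801780170604
  ∷ 1361428195733573328194229261955198715562228294229842928191824281942297213281909183606721818245613561328193613281928192806281928195506281946272819281909245613561356137218281928190906281918061806090628192819561347271806551318060906422656130906370642264226422642264727422637063606573339060906090636063906371347274613561346133713371336133713281919060602050205028722872287220502
  ∷ 1511630197619651929197608291919062908300630196519760830191806291965193906291913063906190618067906790629191906301930193006291929193906301951062919301912067906790679063906291930191206291939061806110630192919790688161806440639061206651979061306190665196519651965198816651915063906810815061506150645061506390688163906790639063906390613063906291919060502050205027608870887080502
  ∷ 1190630066519651929196508290619063008300830196519650830196606301965191906301915061506190619066506650629191906301930193006291929193906291919062919301912067906790679061906301930191206291919061906120630192919790691161906190619061206651979061506190665196519651965199116651915064506650815061506120645061506390691163906790639063906390615063906301919060502050205027608760876080502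
  ∷ 1190630066519651928196508291419062908300630196519650830196606291965191906291915061506190619066506650630191906301930193006301929194506301919062919301915066506650665061906291930191506291919061906150630192919650691161906190619061506651965061506190665196519651965199116651915064506650815061306120645061506190691164506650645061906190615061906281919060504050405047608760876080504
  ∷ 1511630197608651929197608290619062908260630196519760830191806291965193906291913063906190618062906260629191906301930063006291929193906291951062919301911062906290629063906291930061106291939061806110630192919290688161806440639061106651926061306190665196519651965198816651915061906810815061506110619061506390688163906290639063906390613063906291919060502050205027608870887080502
  ∷ 1190630196508651930196508301919063008300630196519760830191906301965191906301915061506190619067906790630191906301930193006301930194506301966063019301915067906790679061906301930191506301919061906150630193019790691161906660619061506651979061506190665196519651965199116651915061906760815061506150619061506190691164506790645061906190615061906301919060502050205027608760876080502
  ∷ 1511430148708811929144226291424062815261542264226760830191823281942262406281913242406240618242806260628192406301930193006281928193906281951062819301911242806280628062406281931060906281924061806090630192819290667161806510624061106422626061306240642264226422642266716422615064606810839061506090624062406240667163906290639062406240613062406291919060602050205028715871587150502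
  ∷ 1190630066519651929196508290619062808300830196519650830196606301965191906301915061506190618066506650630191906301930193006301928194506301919062819301912067906790679061906301930191506281919061806090630192919790688161806190619061206421979061506190665196519651965199116651915063906650815061506150639061506390691163906790639063906390615063906301919060504050205027608760876080502
  ∷ 1190630066508651930066508300619063008300630196519650830061906301965191906301915061506190619063006300630191906301930063006301930194506301919063019301915063006300630061906301930061506301919061906150630193019300665161906190619061506651930061506190665196519651965196516651915061906650815061506150619061506190691164506300645061906190615061906301919060502050205027608760876080502
  ∷ 1551428195733573328198429261955198715562228294229842928191824281942297213281911185106721818245613561328193613281928192806281928195513281955272819281909245613561356137218281928191106281918061806090628192819561347271806551318061106422656131206370642264226422642264727422646063606573339060906090636063906371347274613561346133713371336133713281919060602050205028722872287220502
  ∷ 1182328244217422628264217282428232817281728264226421728261823282642261823282609230923182318242826281728261824282628242826282628264623282618232826282609242826282628261823282628240924282618241824092428262826282642261824182318240924422628170924182442264226422642264226422609241824421746240924092418240924462442264624282646244624462446244624282618240604060406048017801780170604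
  ∷ 1711629065708571929065708290619062908290629196519760829191906291965191906291912061206190619062906290629191906291929062906291929193906291975162919291912067506290629061906291929191206291939061906120629192919290665163906440639061206651929061206390665196519651965198816651912061906573315061206120619061206190688163906750639063906390639063906291919060502050205028108810881080502
  ∷ 1391430148108811928144226261924068715261542264226761930191823281942262406281913242406240618242806260628192406301930143006281928192406281924062819301911242806280628062406281931060906281918061806090630192819280667161806240624061106422626061306240642264226422642266716422615064606811939061306090624062406240667163906280639062406240613062406281919060604050405048715871587150504
  ∷ 1391430148108811928144226261924062815260642264226760830191823281942262406281913242406240618242806260628192406301930143006281928193906281924062819301911242806280628062406281931060906281918061806090630192819280667161806240624061106422626061306240642264226422642266716422615064606810839061306090624062406240667163906280639062406240613062406281919060604050405048715871587150504
  ∷ 1182328244226422628264217282618232817281728264226421728261823282642261823282609230923182318244226421728261823282628242826282628264623282618232826282609244226422642261823282628240924282618241824092428262826422642261824182318240924422642260924462442264226422642264226422609241824421739240924092418240924462442264624422646244624462446244624282618240604060406048017801780170604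
  ∷ 1391430148108811928144226261424062815260642264226760830191823281942262406281913242406240618242806260628192406301930143006281928192406281924062819301911242806280628062406281931060906281918061806090630192819280667161806240624061106422626061306240642264226422642266716422615061806810839061306090618062406240667163906280639062406240613062406281919060604050405048715871587150504
  ∷ 1190629066508651929066508290619062908290829196519760829191906291965191906291912061206190619062906290629191906291929062906291929193906291966062919291915062906290629061906291929061206291919061906150629192919290665161906660619061206651929061206190665196519651965199116651912061906760815061206120619061206390691163906290639063906390615063906291919060502050205027608760876080502
  ∷ 1182328244226422628264229282472234217421728264229422928261823282642297223282609230923722318244226421728267224282628242826282628262823282646232826282609244226422642267223282628240924282618241824092428262826422642261824722318240924422642260924182442264226422642264226422609241824422646240924092418240924462442264624422646244624462446244624282618240604060406048017801780170604
  ∷ 1551430148108811928144226261424062815260642264226760830191823281942262406281913242406510618242806260628194606301930143006281928192406281978062819301911242806280628065106281931060906281924061806090630192819280678162406240624063906422626061306240642264226422642267816422615061806810839061306090618062406240678163906280639062406240613062406281919060604050405048712901290120504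
  ∷ 1181028244226422628264229282472104217421728264229422928261810282642297210282609100910721018104226421728267210282628242826282628262810282646102826282609104226422642207210282628100910282618101810091028262826422042261810721018100910422642260910181042264226422642264226422609101810422646100910091018100910461042264610422046104610461046104610282618100604060406048017801780170604
  ∷ 1721028244217422128264217282618102807280728264226421728261810282642261810282609104610181018102826280728261810282628242826282628263910282655102826282609102830282628201810282628100910282646101810091028262826282042284610461046104610422628070910461042264226422642264228422609101810801739100910091018100910461042283910282039104610391013103910282618100604060406048007800780070604
  ∷ 1181428145726422628194229261955144215422228264229422928191823281942297223281909233606722318245626562628193624281928142606281926195506281955232819281909245626562656267223281928140906281918061806090628192819562642261806552318060906422656260906370642264226422642264726422609063606572639060906090636060906372447264624562646243724372436243724281918060604050405048715872287220504
  ∷ 1860630067608651929067608290619062908260630196519760830191906291965191906291915061906190619062906300629191906301930193006291930191906291970062919301912065106290629061906291930061106291919061906110630192919290670161906660619063906651930061306190665196519651965197016651915061906760815061306120619061506190670164506510645061906190613061906291919060502050205027608890889090502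
  ∷ 1182328244217422628264226292428232817281728264226422628241823282642261823282609230923372318242826281728263724282628242826282628263723282618232826282609242826282628263723282628240924282618241824092428262826282642261824462318240924422628260924182442264226422642264226422609241824422646240924092418240924372442264624282646243724372437243724282618240604060406048017801780170604
  ∷ 1551028145717422128144217281018102817280728264226421728191810282642261806282609103610180618102806260728261806281928142826282626193706282655102826282609102830282628201806282628100910281937061806090628262826282042163706371046064610422628070910461042264226422642264216422609101810801746100906091018060910370642283906282046103706371046103710282618100604050406048007800780070604
  ∷ 1551028145717422128144217281018102817280728264226421728191810282642261806282609103610180618102806260728261806281928142826282626193706282655102826282609102830282628201806282628100910281937061806090628262826282042163706371046064610422628070910461042264226422642264216422609101810801746100906091018060910370642283906282046103706371046103710282618100604050406048007800780070604
  ∷ [])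

-- Each field is the truth of a closed Boolean term, so type checking evaluates the whole
-- certificate. Neither the search nor the encoding has to be trusted: closure is tested on the
-- decoded types, and a wrong hint could only make the test fail.
openCertificate : Certificate.Closed open′ 4 openLefts openRights openHints
openCertificate = record { bares = _ ; bareChords = _ ; weakens = _ ; glues = _ ; finals = _ }

closedLefts closedRights : List Type
closedLefts = map decodeType (
    (1050304 ∷ 1050305 ∷ [])
  ∷ (1050404 ∷ 1050405 ∷ [])
  ∷ (1050303 ∷ 1050305 ∷ [])
  ∷ (1030203 ∷ 1050305 ∷ [])
  ∷ (1030204 ∷ 1050305 ∷ [])
  ∷ (1050403 ∷ 1050405 ∷ [])
  ∷ (10302 ∷ 1050303 ∷ 10505 ∷ [])
  ∷ (10302 ∷ 1050403 ∷ 10505 ∷ [])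
  ∷ (10402 ∷ 1050403 ∷ 10505 ∷ [])
  ∷ (10203 ∷ 11004 ∷ 120100205 ∷ [])
  ∷ (1100204 ∷ 120100205 ∷ [])
  ∷ (1050302 ∷ 1050410 ∷ 10520 ∷ [])
  ∷ (1050402 ∷ 1050410 ∷ 10520 ∷ [])
  ∷ (1100304 ∷ 12015050305 ∷ [])
  ∷ (1050403 ∷ 10505 ∷ 10410 ∷ 10515 ∷ 10520 ∷ [])
  ∷ (10203 ∷ 11004 ∷ 12015050305 ∷ [])
  ∷ (1050303 ∷ 10505 ∷ 10410 ∷ 10515 ∷ 10520 ∷ [])
  ∷ (10502 ∷ 1050303 ∷ 120100305 ∷ [])
  ∷ (1050302 ∷ 1050203 ∷ 1030205 ∷ [])
  ∷ (10302 ∷ 1100503 ∷ 10505 ∷ 10410 ∷ 10515 ∷ 10520 ∷ [])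
  ∷ (1050303 ∷ 1030205 ∷ 1050410 ∷ 10520 ∷ [])
  ∷ (10202 ∷ 11003 ∷ 12005 ∷ 10310 ∷ 12015 ∷ 1150520 ∷ [])
  ∷ (1100303 ∷ 120150505 ∷ 10310 ∷ 10515 ∷ 10520 ∷ [])
  ∷ (1050303 ∷ 120100305 ∷ 10510 ∷ 11415 ∷ 10520 ∷ [])
  ∷ (1050303 ∷ 120100205 ∷ 10510 ∷ 10315 ∷ 10520 ∷ [])
  ∷ (120100000 ∷ 120100010 ∷ 1100020 ∷ [])
  ∷ [])
closedRights = map decodeType (
    (1050403 ∷ 1050405 ∷ [])
  ∷ (1050404 ∷ 1050405 ∷ [])
  ∷ (1030203 ∷ 1050305 ∷ [])
  ∷ (1050303 ∷ 1050305 ∷ [])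
  ∷ (10302 ∷ 1050303 ∷ 10505 ∷ [])
  ∷ (10402 ∷ 1050403 ∷ 10505 ∷ [])
  ∷ (1050304 ∷ 1050305 ∷ [])
  ∷ (1030204 ∷ 1050305 ∷ [])
  ∷ (1050303 ∷ 1030205 ∷ [])
  ∷ (1050203 ∷ 1030205 ∷ [])
  ∷ (10203 ∷ 10304 ∷ 1050305 ∷ [])
  ∷ (1050302 ∷ 1050410 ∷ 10520 ∷ [])
  ∷ (1050400 ∷ 1050410 ∷ 10520 ∷ [])
  ∷ (10203 ∷ 11004 ∷ 120100205 ∷ [])
  ∷ (1050402 ∷ 1050410 ∷ 10520 ∷ [])
  ∷ (1050403 ∷ 10505 ∷ 10310 ∷ 10520 ∷ [])
  ∷ (1050403 ∷ 10505 ∷ 10410 ∷ 10520 ∷ [])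
  ∷ (1050302 ∷ 1050310 ∷ 10520 ∷ [])
  ∷ (1100303 ∷ 120100305 ∷ [])
  ∷ (1100203 ∷ 120100205 ∷ [])
  ∷ (1100204 ∷ 120100205 ∷ [])
  ∷ (1100304 ∷ 120150305 ∷ [])
  ∷ (1100003 ∷ 120100005 ∷ [])
  ∷ (10303 ∷ 11004 ∷ 120150305 ∷ [])
  ∷ (1100203 ∷ 120150305 ∷ [])
  ∷ (1100004 ∷ 120100005 ∷ [])
  ∷ (1050300 ∷ 1050310 ∷ 10520 ∷ [])
  ∷ (10302 ∷ 10503 ∷ 10505 ∷ 10310 ∷ 10520 ∷ [])
  ∷ (10302 ∷ 10503 ∷ 10505 ∷ 10410 ∷ 10520 ∷ [])
  ∷ (1150303 ∷ 120100305 ∷ [])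
  ∷ (1100303 ∷ 120150305 ∷ [])
  ∷ (11003 ∷ 10204 ∷ 120100205 ∷ [])
  ∷ (1050300 ∷ 1050310 ∷ 1030220 ∷ [])
  ∷ (1050303 ∷ 120100305 ∷ 10510 ∷ [])
  ∷ (1201003 ∷ 10304 ∷ 120150305 ∷ [])
  ∷ (10203 ∷ 11004 ∷ 12015050305 ∷ [])
  ∷ (12002 ∷ 120100203 ∷ 1100205 ∷ [])
  ∷ (1050302 ∷ 1050310 ∷ 1030220 ∷ [])
  ∷ (10202 ∷ 11003 ∷ 12005 ∷ 10310 ∷ 12015 ∷ 10520 ∷ [])
  ∷ (1050303 ∷ 11004 ∷ 120100305 ∷ [])
  ∷ (1100303 ∷ 120150505 ∷ 10310 ∷ 10520 ∷ [])
  ∷ (120100203 ∷ 1100205 ∷ 12010 ∷ 11020 ∷ [])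
  ∷ (120150303 ∷ 1100305 ∷ 12010 ∷ 11020 ∷ [])
  ∷ (120100003 ∷ 1100005 ∷ 12010 ∷ 11020 ∷ [])
  ∷ (1201502 ∷ 120050303 ∷ 1100305 ∷ [])
  ∷ (12002 ∷ 1100203 ∷ 1100205 ∷ 12010 ∷ 11020 ∷ [])
  ∷ (120150303 ∷ 1100305 ∷ 12010 ∷ 11520 ∷ [])
  ∷ (1201002 ∷ 1200303 ∷ 1150505 ∷ 10210 ∷ 10220 ∷ [])
  ∷ (120150300 ∷ 120100310 ∷ 1100320 ∷ [])
  ∷ (120100202 ∷ 120100210 ∷ 1100220 ∷ [])
  ∷ (120100200 ∷ 120100210 ∷ 1100220 ∷ [])
  ∷ (120150302 ∷ 120150310 ∷ 1100320 ∷ [])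
  ∷ (120100000 ∷ 120100010 ∷ 1100020 ∷ [])
  ∷ (120100002 ∷ 120100010 ∷ 1100020 ∷ [])
  ∷ (120150302 ∷ 120150310 ∷ 1100220 ∷ [])
  ∷ (1201502 ∷ 10303 ∷ 1100305 ∷ 1201510 ∷ 1100320 ∷ [])
  ∷ [])

closedHints : List (List (ℕ × ℕ))
closedHints = map decodeHints (
    100001410141012101410121014101210000000000000000000000000000000000000141014100000000001010000121001010000000000000000121001010000000000000101010100000000141000000000141000001210141000000000000001010101000000000000000001010000
  ∷ 100001410141012101410121014101210000000000000000000000000000000000000141014100000000001010000121001010000000000000000121001010000000000000101010100000000141000000000141000001210141000000000000001010101000000000000000001010000
  ∷ 103021709170926091709260917092609030203020302030203020302030203020302170917090302030206050302260906050302030203020302260906050302030203020605060503020302170903020302170903022609170903020302030206050605030203020302030206050302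
  ∷ 103021709170926091709260917092609030203020302030203020302030203020302170917090302030206050302260906050302030203020302260906050302030203020605060503020302170903020302170903022609170903020302030206050605030203020302030206050302
  ∷ 100001410141012101410121014101210000000000000000000000000000000000000141014100000000001010000121001010000000000000000121001010000000000000101010100000000141000000000141000001210141000000000000001010101000000000000000001010000
  ∷ 103021709170926091709260917092609030203020302030203020302030203020302170917090302030206050302260906050302030203020302260906050302030203020605060503020302170903020302170903022609170903020302030206050605030203020302030206050302
  ∷ 103021709170926091709260917092609081703020202020202020302020208170202370917090202020206050202260906050302030237093709320906050202030202020605060502020302370908170817370902023209370902020202020206050605081808180202020206050202
  ∷ 103021709170926091709260917092609081703020202020202020302020208170202370917090202020206050202260906050302030237093709320906050202030202020605060502020302370908170817370902023209370902020202020206050605081808180202020206050202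
  ∷ 103021709170926091709260917092609081703020302020203020302030208170202370917090302030206050202260906050302030237093709320906050302030203020605060503020302370908170817370903023209370903020202020206050605081808180202030206050202
  ∷ 103021109141012101109121014101209030200000000030200000000000000000101151317090000010100000302260900000000000003020302260901010000010100000101010100000000170903020302170901012609170906050302030206050605030203020302030206050302
  ∷ 100001410141012101410121014101210000000000000000000000000000000000000161314100000010100000000121000000000000000000000121001010000000000000101010100000000141000000000141001011210141001010000000001010101000000000000000001010000
  ∷ 119114921492150214921502149215021411119111911191119111911191141111911492149211911191120121911502120121911191145114511502120121911191119112012201219111911492141114111492119115021492113111911191120122012361136111911191120121911
  ∷ 119114921492150214921502149215021411119111911191119111911191141111911492149211911191120121911502120121911191145114511502120121911191119112012201219111911492141114111492119115021492113111911191120122012361136111911191120121911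
  ∷ 114101410141012101410121014101210141000000000000000000000000000000000050414100000000000000000121000000000000000000000121001010000010100000101010100000000141000000000141000001210141000000000000001010101000000000000000001010000
  ∷ 103021709170926091709260917092609462303020302030203020302030242230302510917090302030206050302260906050302030251095109480906050302030203020605060503020302510942234223510903024809510903020302030206050605442044200302030206050302
  ∷ 103021109141012101109121014101209030200000000030200000000000000000101151317090000010100000302260900000000000003020302260901010000010100000101010100000000170903020302170901012609170906050302030206050605030203020302030206050302
  ∷ 103021709170926091709260917092609462303020302030203020302030242230302510917090302030206050302260906050302030251095109480906050302030203020605060503020302510942234223510903024809510903020302030206050605442044200302030206050302
  ∷ 102061709170926091709260917092609020202020202020202020202020202020202271517090202020207080202260906050202020203020302260906050202020602020605060502020202170902020202170902022609170902020202020206050605020202020202020206050202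
  ∷ 102021709170926091709260917092609020202020202020202020202020202020202170917090202020206050202260906050202020202020202260906050202020202020605060502020202170902020202170902022609170902020202020206050605020202020202020206050202
  ∷ 103021709170926091709260917092609081703020202020202020302020208170202540917090202020206050202260906050302030245094509500906050202030202020605060502020302490941114111490902025009490902020202020206050605361136110202020206050202
  ∷ 103021709170926091709260917092609030203020302030203020302030203020302170917090302030206050302260906050302030203020302260906050302030203020605060503020302170903020302170903022609170903020302030206050605030203020302030206050302
  ∷ 137095109510948093709480951093209091808171824091818230817182302061007472249211820341403022419502123160206020645114511502121143016100718160708211418160206492141114111492134145021492131121911191120122012361136111911191120121911
  ∷ 117091709170926091709260917092609170903020302030203020302030203020302040317090302030203020302260903020302030255245524480906050302060503020605060503020302510942234223510903024809510903020302030206050605442044200302030206050302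
  ∷ 118241709170926091709260917092609030203020302030203020302030203020302271517090302030221140302260906050302030203020302260906050302181603020605060503020302170903020302170903022609170903020302030206050605030203020302030206050302
  ∷ 103021709170926091709260917092609030203020302030203020302030203020302271517090302181606050302260921140302030203020302260906050302030203020605060503020302170903020302170918162609170906050302030206050605030203020302030206050302
  ∷ 122115321532152215321522153215221221122112211221122112211221122112211431153212211251222112211522122112211221122112211522125122211221122112512251222112211532122112211532125125221532125122211221125122512221122112211221125122211
  ∷ [])

closedCertificate : Certificate.Closed closed′ 3 closedLefts closedRights closedHints
closedCertificate = record { bares = _ ; bareChords = _ ; weakens = _ ; glues = _ ; finals = _ }

iUMo≤4 : ∀ G → 𝒪⁺ G → UM-colourable open′ G 4
iUMo≤4 G (planar , noIsolated) = um-colourable open′ openCertificate (s≤s z≤n) G planar λ _ → noIsolated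

iUMc≤3 : ∀ G → 𝒪 G → UM-colourable closed′ G 3
iUMc≤3 G planar = um-colourable closed′ closedCertificate (s≤s z≤n) G planar λ ()

Max≤-weaken : ∀ {χ 𝒞 k k′} → k ≤ k′ → Max≤ χ 𝒞 k → Max≤ χ 𝒞 k′
Max≤-weaken k≤k′ max G G∈𝒞 = let m , χm , m≤k = max G G∈𝒞 in m , χm , ≤-trans m≤k k≤k′

max≤-iCFo : Max≤ χ-iCFo 𝒪⁺ 4
max≤-iCFo G G∈𝒪⁺ = minimum (CF-colourable? open′ G) (UM-colourable⇒CF-colourable open′ G (iUMo≤4 G G∈𝒪⁺))

max≤-iUMo : Max≤ χ-iUMo 𝒪⁺ 4
max≤-iUMo G G∈𝒪⁺ = minimum (UM-colourable? open′ G) (iUMo≤4 G G∈𝒪⁺)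

max≤-iCFc : Max≤ χ-iCFc 𝒪 3
max≤-iCFc G G∈𝒪 = minimum (CF-colourable? closed′ G) (UM-colourable⇒CF-colourable closed′ G (iUMc≤3 G G∈𝒪))

max≤-iUMc : Max≤ χ-iUMc 𝒪 3
max≤-iUMc G G∈𝒪 = minimum (UM-colourable? closed′ G) (iUMc≤3 G G∈𝒪)

Triangle∈𝒪⁺ : 𝒪⁺ Triangle.graph
Triangle∈𝒪⁺ = Triangle.outerplanar , toWitness {a? = noIsolated? Triangle.graph} _

Fans∈𝒪⁺ : 𝒪⁺ Fans.graph
Fans∈𝒪⁺ = Fans.outerplanar , toWitness {a? = noIsolated? Fans.graph} _

max≥-iCFo : Max≥ χ-iCFo 𝒪⁺ 3
max≥-iCFo = let m , χm , _ = max≤-iCFo Triangle.graph Triangle∈𝒪⁺ in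
  Triangle.graph , Triangle∈𝒪⁺ , m , χm , minimum-> (CF-weaken open′ Triangle.graph) triangle χm

max≡-iCFc : Max≡ χ-iCFc 𝒪 3
max≡-iCFc = let m , χm , m≤3 = max≤-iCFc Bull.graph Bull.outerplanar in
  (Bull.graph , Bull.outerplanar ,
    subst (χ-iCFc Bull.graph) (≤-antisym m≤3 (minimum-> (CF-weaken closed′ Bull.graph) bull χm)) χm) ,
  max≤-iCFc

max≥-iUMo : Max≥ χ-iUMo 𝒪⁺ 4
max≥-iUMo = let m , χm , _ = max≤-iUMo Fans.graph Fans∈𝒪⁺ in
  Fans.graph , Fans∈𝒪⁺ , m , χm , minimum-> (UM-weaken open′ Fans.graph) fans χm

max≥-iUMc : Max≥ χ-iUMc 𝒪 3
max≥-iUMc = let m , χm , _ = max≤-iUMc Bull.graph Bull.outerplanar in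
  Bull.graph , Bull.outerplanar , m , χm ,
  minimum-> (UM-weaken closed′ Bull.graph) (bull ∘ UM-colourable⇒CF-colourable closed′ Bull.graph) χm

theorem1p2 : (Max≥ χ-iCFo 𝒪⁺ 3 × Max≤ χ-iCFo 𝒪⁺ 4)
    × Max≡ χ-iCFc 𝒪 3
    × (Max≥ χ-iUMo 𝒪⁺ 4 × Max≤ χ-iUMo 𝒪⁺ 5)
    × (Max≥ χ-iUMc 𝒪 3 × Max≤ χ-iUMc 𝒪 5)
theorem1p2 =
    (max≥-iCFo , max≤-iCFo)
  , max≡-iCFc
  , (max≥-iUMo , Max≤-weaken (n≤1+n 4) max≤-iUMo)
  , (max≥-iUMc , Max≤-weaken (m≤n+m 3 2) max≤-iUMc)
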